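{- For any integer $m\geq 1$, any function $\varphi:A\to\mathbb{C}$ on $A=\mathbb{Z}/m\mathbb{Z}$, any interval $I$ in $A$, and any subset $D\subset A$, we have $$|S(\varphi;I)|\leq 2\|\varphi\|_\infty^{1/3}\Bigl\{|D|^{1/3}|I|^{1/3}\|\varphi\|_2^{2/3}+|I|^{2/3}\max_{a\notin D}|\mathcal{C}(\varphi,a)|^{1/3}+\frac{2}{3}|I|^{2/3}\|\varphi\|_\infty^{2/3}\Bigr\}.$$
   Context: For a finite abelian group $A$, a function $\varphi:A\to\mathbb{C}$ and a subset $B\subset A$: $S(\varphi;B)=\sum_{x\in B}\varphi(x)$, $\|\varphi\|_\infty=\max_{x\in A}|\varphi(x)|$, $\|\varphi\|_2=\bigl(\sum_{x\in A}|\varphi(x)|^2\bigr)^{1/2}$, and for $a\in A$ the additive correlation is $\mathcal{C}(\varphi,a)=\sum_{x\in A}\varphi(x)\overline{\varphi(x+a)}$. An interval in $\mathbb{Z}/m\mathbb{Z}$ is a subset which is the reduction modulo $m$ of an interval of consecutive integers on which reduction modulo $m$ is injective. If $D=A$, the maximum over $a\notin D$ is interpreted as $0$. -}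

module Defs where

open import Data.Fin using (Fin; toℕ; fromℕ<)
open import Data.Fin.Subset using (Subset; _∈_; ⊤)
open import Data.Fin.Subset.Properties using (_∈?_)
open import Data.Integer as ℤ using (ℤ; +_; -[1+_])
import Data.Integer.DivMod as ℤ
import Data.Integer.Properties as ℤ
open import Data.List using (List; foldr; map; filter; allFin)
open import Data.Nat as ℕ using (ℕ; zero; suc; NonZero)
import Data.Nat.Properties as ℕ
open import Data.Product using (∃; _×_; _,_; proj₁; proj₂)
open import Data.Rational as ℚ using (ℚ; mkℚ; 0ℚ; 1ℚ; ½)
import Data.Rational.Properties as ℚ
open import Data.Rational.Solver using (module +-*-Solver)
import Data.Rational.Unnormalised as ℚᵘ
import Data.Rational.Unnormalised.Properties as ℚᵘ
open import Data.Sum using (inj₁; inj₂)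
open import Function using (_⇔_)
open import Relation.Binary.PropositionalEquality
open import Relation.Nullary using (¬_; yes; no; contradiction)
open import Relation.Unary using (Decidable)

open import Algebra.Definitions.RawSemiring ℚ.+-*-rawSemiring
  using () renaming (_^_ to _^ℚ_)

------------------------------------------------------------------------
-- Real numbers

-- A real number is a Cauchy sequence of rationals together with a modulus
-- of convergence.  Distinct sequences may represent the same real: equality
-- of reals is _≈_ below.

IsCauchy : (ℕ → ℚ) → Set
IsCauchy s = ∀ ε → 0ℚ ℚ.< ε →
  ∃ λ N → ∀ i j → N ℕ.≤ i → N ℕ.≤ j → ℚ.∣ s i ℚ.- s j ∣ ℚ.≤ ε

record ℝ : Set where
  constructor mkℝ
  field
    seq    : ℕ → ℚ
    cauchy : IsCauchy seq

open ℝ public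

infix 4 _≤_ _≈_

_≤_ : ℝ → ℝ → Set
x ≤ y = ∀ ε → 0ℚ ℚ.< ε →
  ∃ λ N → ∀ n → N ℕ.≤ n → seq x n ℚ.≤ seq y n ℚ.+ ε

_≈_ : ℝ → ℝ → Set
x ≈ y = x ≤ y × y ≤ x

open ℚ.≤-Reasoning

half-pos : ∀ {ε} → 0ℚ ℚ.< ε → 0ℚ ℚ.< ½ ℚ.* ε
half-pos {ε} 0<ε = subst (ℚ._< ½ ℚ.* ε) (ℚ.*-zeroʳ ½) (ℚ.*-monoʳ-<-pos ½ 0<ε)

half+half : ∀ ε → ½ ℚ.* ε ℚ.+ ½ ℚ.* ε ≡ ε
half+half ε = trans (sym (ℚ.*-distribʳ-+ ε ½ ½)) (ℚ.*-identityˡ ε)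

0≤-diff : ∀ {p q} → p ℚ.≤ q → 0ℚ ℚ.≤ q ℚ.- p
0≤-diff {p} {q} p≤q =
  subst (ℚ._≤ q ℚ.- p) (ℚ.+-inverseʳ p) (ℚ.+-monoˡ-≤ (ℚ.- p) p≤q)

p≤q+∣p-q∣ : ∀ p q → p ℚ.≤ q ℚ.+ ℚ.∣ p ℚ.- q ∣
p≤q+∣p-q∣ p q with ℚ.≤-total q p
... | inj₁ q≤p = ℚ.≤-reflexive (begin-equality
  p                        ≡⟨ solve 2 (λ p q → p := q :+ (p :- q)) refl p q ⟩
  q ℚ.+ (p ℚ.- q)          ≡⟨ cong (q ℚ.+_) (ℚ.0≤p⇒∣p∣≡p (0≤-diff q≤p)) ⟨
  q ℚ.+ ℚ.∣ p ℚ.- q ∣      ∎)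
  where open +-*-Solver
... | inj₂ p≤q = begin
  p                        ≤⟨ p≤q ⟩
  q                        ≡⟨ ℚ.+-identityʳ q ⟨
  q ℚ.+ 0ℚ                 ≤⟨ ℚ.+-monoʳ-≤ q (ℚ.0≤∣p∣ (p ℚ.- q)) ⟩
  q ℚ.+ ℚ.∣ p ℚ.- q ∣      ∎

∣p-q∣≡∣q-p∣ : ∀ p q → ℚ.∣ p ℚ.- q ∣ ≡ ℚ.∣ q ℚ.- p ∣
∣p-q∣≡∣q-p∣ p q = trans (cong ℚ.∣_∣ (solve 2 (λ p q → p :- q := :- (q :- p)) refl p q))
                        (ℚ.∣-p∣≡∣p∣ (q ℚ.- p))
  where open +-*-Solver

close : ∀ p q {ε} → ℚ.∣ p ℚ.- q ∣ ℚ.≤ ε → p ℚ.≤ q ℚ.+ ε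
close p q h = ℚ.≤-trans (p≤q+∣p-q∣ p q) (ℚ.+-monoʳ-≤ q h)

close′ : ∀ p q {ε} → ℚ.∣ p ℚ.- q ∣ ℚ.≤ ε → q ℚ.≤ p ℚ.+ ε
close′ p q h = close q p (subst (ℚ._≤ _) (∣p-q∣≡∣q-p∣ p q) h)

unclose₁ : ∀ p q ε → p ℚ.≤ q ℚ.+ ε → p ℚ.- q ℚ.≤ ε
unclose₁ p q ε h = begin
  p ℚ.- q          ≤⟨ ℚ.+-monoˡ-≤ (ℚ.- q) h ⟩
  q ℚ.+ ε ℚ.- q    ≡⟨ solve 2 (λ q ε → q :+ ε :- q := ε) refl q ε ⟩
  ε                ∎
  where open +-*-Solver

unclose : ∀ p q ε → p ℚ.≤ q ℚ.+ ε → q ℚ.≤ p ℚ.+ ε → ℚ.∣ p ℚ.- q ∣ ℚ.≤ ε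
unclose p q ε h₁ h₂ with ℚ.≤-total q p
... | inj₁ q≤p = subst (ℚ._≤ _) (sym (ℚ.0≤p⇒∣p∣≡p (0≤-diff q≤p))) (unclose₁ p q ε h₁)
... | inj₂ p≤q = subst (ℚ._≤ _)
  (sym (trans (∣p-q∣≡∣q-p∣ p q) (ℚ.0≤p⇒∣p∣≡p (0≤-diff p≤q)))) (unclose₁ q p ε h₂)

⊔-close : ∀ p q r s ε → p ℚ.≤ r ℚ.+ ε → q ℚ.≤ s ℚ.+ ε →
          p ℚ.⊔ q ℚ.≤ r ℚ.⊔ s ℚ.+ ε
⊔-close p q r s ε h₁ h₂ = ℚ.⊔-lub
  (ℚ.≤-trans h₁ (ℚ.+-monoˡ-≤ ε (ℚ.p≤p⊔q r s)))
  (ℚ.≤-trans h₂ (ℚ.+-monoˡ-≤ ε (ℚ.p≤q⊔p r s)))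

*-mono-≤ : ∀ p q r s → 0ℚ ℚ.≤ p → 0ℚ ℚ.≤ s → p ℚ.≤ q → r ℚ.≤ s →
           p ℚ.* r ℚ.≤ q ℚ.* s
*-mono-≤ p q r s 0≤p 0≤s p≤q r≤s = ℚ.≤-trans
  (ℚ.*-monoˡ-≤-nonNeg p {{ℚ.nonNegative 0≤p}} r≤s)
  (ℚ.*-monoʳ-≤-nonNeg s {{ℚ.nonNegative 0≤s}} p≤q)

*-nonneg : ∀ p q → 0ℚ ℚ.≤ p → 0ℚ ℚ.≤ q → 0ℚ ℚ.≤ p ℚ.* q
*-nonneg p q 0≤p 0≤q =
  subst (ℚ._≤ p ℚ.* q) (ℚ.*-zeroʳ p) (ℚ.*-monoˡ-≤-nonNeg p {{ℚ.nonNegative 0≤p}} 0≤q)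

+-nonneg : ∀ p q → 0ℚ ℚ.≤ p → 0ℚ ℚ.≤ q → 0ℚ ℚ.≤ p ℚ.+ q
+-nonneg p q = ℚ.+-mono-≤ {0ℚ} {p} {0ℚ} {q}

eventually-bounded : ∀ s → IsCauchy s →
  ∃ λ B → 0ℚ ℚ.< B × ∃ λ N → ∀ n → N ℕ.≤ n → ℚ.∣ s n ∣ ℚ.≤ B
eventually-bounded s c with c 1ℚ (ℚ.positive⁻¹ 1ℚ)
... | N , f = ℚ.∣ s N ∣ ℚ.+ 1ℚ
            , ℚ.+-mono-≤-< (ℚ.0≤∣p∣ (s N)) (ℚ.positive⁻¹ 1ℚ)
            , N , λ n N≤n → begin
  ℚ.∣ s n ∣                              ≡⟨ cong ℚ.∣_∣ (solve 2 (λ a b → a := b :+ (a :- b)) refl (s n) (s N)) ⟩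
  ℚ.∣ s N ℚ.+ (s n ℚ.- s N) ∣            ≤⟨ ℚ.∣p+q∣≤∣p∣+∣q∣ (s N) (s n ℚ.- s N) ⟩
  ℚ.∣ s N ∣ ℚ.+ ℚ.∣ s n ℚ.- s N ∣        ≤⟨ ℚ.+-monoʳ-≤ ℚ.∣ s N ∣ (f n N N≤n ℕ.≤-refl) ⟩
  ℚ.∣ s N ∣ ℚ.+ 1ℚ                       ∎
  where open +-*-Solver

∃-divide : ∀ {ε B} → 0ℚ ℚ.< ε → 0ℚ ℚ.< B → ∃ λ δ → 0ℚ ℚ.< δ × B ℚ.* δ ≡ ε
∃-divide {ε} {B} 0<ε 0<B = ε ℚ.* (ℚ.1/ B) , 0<δ , (begin-equality
  B ℚ.* (ε ℚ.* (ℚ.1/ B))   ≡⟨ solve 3 (λ b e c → b :* (e :* c) := e :* (b :* c)) refl B ε (ℚ.1/ B) ⟩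
  ε ℚ.* (B ℚ.* (ℚ.1/ B))   ≡⟨ cong (ε ℚ.*_) (ℚ.*-inverseʳ B) ⟩
  ε ℚ.* 1ℚ                 ≡⟨ ℚ.*-identityʳ ε ⟩
  ε                        ∎)
  where
  open +-*-Solver
  instance
    pos-B : ℚ.Positive B
    pos-B = ℚ.positive 0<B
    nonZero-B : ℚ.NonZero B
    nonZero-B = ℚ.pos⇒nonZero B
    pos-ε : ℚ.Positive ε
    pos-ε = ℚ.positive 0<ε
    pos-1/B : ℚ.Positive (ℚ.1/ B)
    pos-1/B = ℚ.1/pos⇒pos B
  0<δ : 0ℚ ℚ.< ε ℚ.* (ℚ.1/ B)
  0<δ = ℚ.positive⁻¹ _ {{ℚ.pos*pos⇒pos ε (ℚ.1/ B)}}

opaque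

  const-cauchy : ∀ q → IsCauchy (λ _ → q)
  const-cauchy q ε 0<ε =
    0 , λ _ _ _ _ → subst (ℚ._≤ ε) (sym (cong ℚ.∣_∣ (ℚ.+-inverseʳ q))) (ℚ.<⇒≤ 0<ε)

  +-cauchy : ∀ s t → IsCauchy s → IsCauchy t → IsCauchy (λ n → s n ℚ.+ t n)
  +-cauchy s t c d ε 0<ε =
    let M , f = c (½ ℚ.* ε) (half-pos 0<ε)
        N , g = d (½ ℚ.* ε) (half-pos 0<ε)
    in M ℕ.⊔ N , λ i j p q → begin
      ℚ.∣ s i ℚ.+ t i ℚ.- (s j ℚ.+ t j) ∣
        ≡⟨ cong ℚ.∣_∣ (solve 4 (λ a b c d → a :+ b :- (c :+ d) := (a :- c) :+ (b :- d)) refl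
                         (s i) (t i) (s j) (t j)) ⟩
      ℚ.∣ (s i ℚ.- s j) ℚ.+ (t i ℚ.- t j) ∣
        ≤⟨ ℚ.∣p+q∣≤∣p∣+∣q∣ (s i ℚ.- s j) (t i ℚ.- t j) ⟩
      ℚ.∣ s i ℚ.- s j ∣ ℚ.+ ℚ.∣ t i ℚ.- t j ∣
        ≤⟨ ℚ.+-mono-≤ (f i j (ℕ.m⊔n≤o⇒m≤o M N p) (ℕ.m⊔n≤o⇒m≤o M N q))
                      (g i j (ℕ.m⊔n≤o⇒n≤o M N p) (ℕ.m⊔n≤o⇒n≤o M N q)) ⟩
      ½ ℚ.* ε ℚ.+ ½ ℚ.* ε
        ≡⟨ half+half ε ⟩
      ε ∎
    where open +-*-Solver

  neg-cauchy : ∀ s → IsCauchy s → IsCauchy (λ n → ℚ.- s n)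
  neg-cauchy s c ε 0<ε =
    let N , f = c ε 0<ε
    in N , λ i j p q → subst (ℚ._≤ ε)
      (trans (∣p-q∣≡∣q-p∣ (s i) (s j))
             (cong ℚ.∣_∣ (solve 2 (λ a b → b :- a := :- a :- :- b) refl (s i) (s j))))
      (f i j p q)
    where open +-*-Solver

  *-cauchy : ∀ s t → IsCauchy s → IsCauchy t → IsCauchy (λ n → s n ℚ.* t n)
  *-cauchy s t c d ε 0<ε =
    let B , 0<B , K , bs = eventually-bounded s c
        C , 0<C , L , bt = eventually-bounded t d
        δ , 0<δ , eq     = ∃-divide 0<ε (ℚ.+-mono-< 0<B 0<C)
        M , f = c δ 0<δ
        N , g = d δ 0<δ
    in (K ℕ.⊔ L) ℕ.⊔ (M ℕ.⊔ N) , λ i j p q →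
      let pKL = ℕ.m⊔n≤o⇒m≤o (K ℕ.⊔ L) (M ℕ.⊔ N) p
          qKL = ℕ.m⊔n≤o⇒m≤o (K ℕ.⊔ L) (M ℕ.⊔ N) q
          pMN = ℕ.m⊔n≤o⇒n≤o (K ℕ.⊔ L) (M ℕ.⊔ N) p
          qMN = ℕ.m⊔n≤o⇒n≤o (K ℕ.⊔ L) (M ℕ.⊔ N) q
      in begin
      ℚ.∣ s i ℚ.* t i ℚ.- s j ℚ.* t j ∣
        ≡⟨ cong ℚ.∣_∣ (solve 4 (λ a b c d → a :* b :- c :* d := a :* (b :- d) :+ d :* (a :- c)) refl
                         (s i) (t i) (s j) (t j)) ⟩
      ℚ.∣ s i ℚ.* (t i ℚ.- t j) ℚ.+ t j ℚ.* (s i ℚ.- s j) ∣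
        ≤⟨ ℚ.∣p+q∣≤∣p∣+∣q∣ (s i ℚ.* (t i ℚ.- t j)) (t j ℚ.* (s i ℚ.- s j)) ⟩
      ℚ.∣ s i ℚ.* (t i ℚ.- t j) ∣ ℚ.+ ℚ.∣ t j ℚ.* (s i ℚ.- s j) ∣
        ≡⟨ cong₂ ℚ._+_ (ℚ.∣p*q∣≡∣p∣*∣q∣ (s i) (t i ℚ.- t j)) (ℚ.∣p*q∣≡∣p∣*∣q∣ (t j) (s i ℚ.- s j)) ⟩
      ℚ.∣ s i ∣ ℚ.* ℚ.∣ t i ℚ.- t j ∣ ℚ.+ ℚ.∣ t j ∣ ℚ.* ℚ.∣ s i ℚ.- s j ∣
        ≤⟨ ℚ.+-mono-≤
             (*-mono-≤ ℚ.∣ s i ∣ B ℚ.∣ t i ℚ.- t j ∣ δ (ℚ.0≤∣p∣ (s i)) (ℚ.<⇒≤ 0<δ) (bs i (ℕ.m⊔n≤o⇒m≤o K L pKL))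
               (g i j (ℕ.m⊔n≤o⇒n≤o M N pMN) (ℕ.m⊔n≤o⇒n≤o M N qMN)))
             (*-mono-≤ ℚ.∣ t j ∣ C ℚ.∣ s i ℚ.- s j ∣ δ (ℚ.0≤∣p∣ (t j)) (ℚ.<⇒≤ 0<δ) (bt j (ℕ.m⊔n≤o⇒n≤o K L qKL))
               (f i j (ℕ.m⊔n≤o⇒m≤o M N pMN) (ℕ.m⊔n≤o⇒m≤o M N qMN))) ⟩
      B ℚ.* δ ℚ.+ C ℚ.* δ
        ≡⟨ ℚ.*-distribʳ-+ δ B C ⟨
      (B ℚ.+ C) ℚ.* δ
        ≡⟨ eq ⟩
      ε ∎
    where open +-*-Solver

  ⊔-cauchy : ∀ s t → IsCauchy s → IsCauchy t → IsCauchy (λ n → s n ℚ.⊔ t n)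
  ⊔-cauchy s t c d ε 0<ε =
    let M , f = c ε 0<ε
        N , g = d ε 0<ε
    in M ℕ.⊔ N , λ i j p q →
      let fij = f i j (ℕ.m⊔n≤o⇒m≤o M N p) (ℕ.m⊔n≤o⇒m≤o M N q)
          gij = g i j (ℕ.m⊔n≤o⇒n≤o M N p) (ℕ.m⊔n≤o⇒n≤o M N q)
      in unclose (s i ℚ.⊔ t i) (s j ℚ.⊔ t j) ε
        (⊔-close (s i) (t i) (s j) (t j) ε (close (s i) (s j) fij) (close (t i) (t j) gij))
        (⊔-close (s j) (t j) (s i) (t i) ε (close′ (s i) (s j) fij) (close′ (t i) (t j) gij))

fromℚ : ℚ → ℝ
fromℚ q = mkℝ (λ _ → q) (const-cauchy q)

fromℕ : ℕ → ℝ
fromℕ n = fromℚ (+ n ℚ./ 1)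

0ℝ 1ℝ : ℝ
0ℝ = fromℚ 0ℚ
1ℝ = fromℚ 1ℚ

infixl 6 _+_ _-_ _⊔_
infixl 7 _*_
infix  8 -_

-_ : ℝ → ℝ
- x = mkℝ (λ n → ℚ.- seq x n) (neg-cauchy (seq x) (cauchy x))

_+_ _-_ _*_ _⊔_ : ℝ → ℝ → ℝ
x + y = mkℝ (λ n → seq x n ℚ.+ seq y n) (+-cauchy (seq x) (seq y) (cauchy x) (cauchy y))
x - y = x + - y
x * y = mkℝ (λ n → seq x n ℚ.* seq y n) (*-cauchy (seq x) (seq y) (cauchy x) (cauchy y))
x ⊔ y = mkℝ (λ n → seq x n ℚ.⊔ seq y n) (⊔-cauchy (seq x) (seq y) (cauchy x) (cauchy y))

infixr 8 _^_

_^_ : ℝ → ℕ → ℝ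
x ^ zero  = 1ℝ
x ^ suc n = x * x ^ n

------------------------------------------------------------------------
-- Roots

greatest : ∀ {P : ℕ → Set} → Decidable P → ℕ → ℕ
greatest P? zero    = zero
greatest P? (suc b) with P? (suc b)
... | yes _ = suc b
... | no  _ = greatest P? b

greatest-spec : ∀ {P : ℕ → Set} (P? : Decidable P) b → P 0 → ¬ P b →
                P (greatest P? b) × ¬ P (suc (greatest P? b))
greatest-spec {P} P? zero    p₀ ¬pb = contradiction p₀ ¬pb
greatest-spec {P} P? (suc b) p₀ ¬pb with P? (suc b)
... | yes p = contradiction p ¬pb
... | no ¬p with P? b
...   | no ¬p′ = greatest-spec P? b p₀ ¬p′
...   | yes p′ = subst (λ j → P j × ¬ P (suc j)) (sym (at b p′)) (p′ , ¬p)
  where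
  at : ∀ b → P b → greatest P? b ≡ b
  at zero    _ = refl
  at (suc b) p with P? (suc b)
  ... | yes _ = refl
  ... | no ¬p = contradiction p ¬p

^-nonneg : ∀ p k → 0ℚ ℚ.≤ p → 0ℚ ℚ.≤ p ^ℚ k
^-nonneg p zero    _   = ℚ.<⇒≤ (ℚ.positive⁻¹ 1ℚ)
^-nonneg p (suc k) 0≤p = *-nonneg p (p ^ℚ k) 0≤p (^-nonneg p k 0≤p)

^-pos : ∀ p k → 0ℚ ℚ.< p → 0ℚ ℚ.< p ^ℚ k
^-pos p zero    _   = ℚ.positive⁻¹ 1ℚ
^-pos p (suc k) 0<p = ℚ.positive⁻¹ (p ℚ.* p ^ℚ k)
  {{ℚ.pos*pos⇒pos p {{ℚ.positive 0<p}} (p ^ℚ k) {{ℚ.positive (^-pos p k 0<p)}}}}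

^-mono-≤ : ∀ p q k → 0ℚ ℚ.≤ p → p ℚ.≤ q → p ^ℚ k ℚ.≤ q ^ℚ k
^-mono-≤ p q zero    _   _   = ℚ.≤-refl
^-mono-≤ p q (suc k) 0≤p p≤q = *-mono-≤ p q (p ^ℚ k) (q ^ℚ k)
  0≤p (^-nonneg q k (ℚ.≤-trans 0≤p p≤q)) p≤q (^-mono-≤ p q k 0≤p p≤q)

0≤1 : 0ℚ ℚ.≤ 1ℚ
0≤1 = ℚ.<⇒≤ (ℚ.positive⁻¹ 1ℚ)

1≤^ : ∀ p k → 1ℚ ℚ.≤ p → 1ℚ ℚ.≤ p ^ℚ k
1≤^ p zero    _   = ℚ.≤-refl
1≤^ p (suc k) 1≤p = *-mono-≤ 1ℚ p 1ℚ (p ^ℚ k)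
  0≤1 (^-nonneg p k (ℚ.≤-trans 0≤1 1≤p)) 1≤p (1≤^ p k 1≤p)

≤-^suc : ∀ p k → 1ℚ ℚ.≤ p → p ℚ.≤ p ^ℚ suc k
≤-^suc p k 1≤p = subst (ℚ._≤ p ^ℚ suc k) (ℚ.*-identityʳ p)
  (*-mono-≤ p p 1ℚ (p ^ℚ k) 0≤p (^-nonneg p k 0≤p) ℚ.≤-refl (1≤^ p k 1≤p))
  where 0≤p = ℚ.≤-trans 0≤1 1≤p

^-superadditive : ∀ p q k → 0ℚ ℚ.≤ p → 0ℚ ℚ.≤ q →
                  p ^ℚ suc k ℚ.+ q ^ℚ suc k ℚ.≤ (p ℚ.+ q) ^ℚ suc k
^-superadditive p q k 0≤p 0≤q = begin
  p ℚ.* p ^ℚ k ℚ.+ q ℚ.* q ^ℚ k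
    ≤⟨ ℚ.+-mono-≤ {p ℚ.* p ^ℚ k} {p ℚ.* (p ℚ.+ q) ^ℚ k} {q ℚ.* q ^ℚ k} {q ℚ.* (p ℚ.+ q) ^ℚ k}
         (*-mono-≤ p p (p ^ℚ k) ((p ℚ.+ q) ^ℚ k) 0≤p 0≤[p+q]ᵏ ℚ.≤-refl (^-mono-≤ p (p ℚ.+ q) k 0≤p p≤p+q))
         (*-mono-≤ q q (q ^ℚ k) ((p ℚ.+ q) ^ℚ k) 0≤q 0≤[p+q]ᵏ ℚ.≤-refl (^-mono-≤ q (p ℚ.+ q) k 0≤q q≤p+q)) ⟩
  p ℚ.* (p ℚ.+ q) ^ℚ k ℚ.+ q ℚ.* (p ℚ.+ q) ^ℚ k
    ≡⟨ ℚ.*-distribʳ-+ ((p ℚ.+ q) ^ℚ k) p q ⟨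
  (p ℚ.+ q) ℚ.* (p ℚ.+ q) ^ℚ k ∎
  where
  0≤[p+q]ᵏ = ^-nonneg (p ℚ.+ q) k (+-nonneg p q 0≤p 0≤q)
  p≤p+q : p ℚ.≤ p ℚ.+ q
  p≤p+q = subst (ℚ._≤ p ℚ.+ q) (ℚ.+-identityʳ p) (ℚ.+-monoʳ-≤ p 0≤q)
  q≤p+q : q ℚ.≤ p ℚ.+ q
  q≤p+q = subst (ℚ._≤ p ℚ.+ q) (ℚ.+-identityˡ q) (ℚ.+-monoˡ-≤ q 0≤p)

opaque

  grid : ℕ → ℕ → ℚ
  grid n j = + j ℚ./ suc n

  grid-toℚᵘ : ∀ n j → ℚ.toℚᵘ (grid n j) ℚᵘ.≃ ℚᵘ.mkℚᵘ (+ j) n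
  grid-toℚᵘ n j = ℚ.toℚᵘ-fromℚᵘ (ℚᵘ.mkℚᵘ (+ j) n)

  grid-zero : ∀ n → grid n 0 ≡ 0ℚ
  grid-zero n = ℚ.toℚᵘ-injective (ℚᵘ.≃-trans (grid-toℚᵘ n 0) (ℚᵘ.*≡* refl))

  grid-nonneg : ∀ n j → 0ℚ ℚ.≤ grid n j
  grid-nonneg n j = ℚ.toℚᵘ-cancel-≤ (ℚᵘ.≤-trans
    (ℚᵘ.*≤* (ℤ.≤-trans (ℤ.+≤+ ℕ.z≤n) (ℤ.≤-reflexive (sym (ℤ.*-identityʳ (+ j))))))
    (ℚᵘ.≤-reflexive (ℚᵘ.≃-sym (grid-toℚᵘ n j))))

  grid-suc : ∀ n j → grid n (suc j) ≡ grid n j ℚ.+ grid n 1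
  grid-suc n j = ℚ.toℚᵘ-injective (ℚᵘ.≃-trans (grid-toℚᵘ n (suc j))
    (ℚᵘ.≃-trans {j = ℚᵘ.mkℚᵘ (+ j) n ℚᵘ.+ ℚᵘ.mkℚᵘ (+ 1) n} (ℚᵘ.*≡* lemℤ)
      (ℚᵘ.≃-sym (ℚᵘ.≃-trans (ℚ.toℚᵘ-homo-+ (grid n j) (grid n 1))
                            (ℚᵘ.+-cong (grid-toℚᵘ n j) (grid-toℚᵘ n 1))))))
    where
    lem : suc j ℕ.* (suc n ℕ.* suc n) ≡ (j ℕ.* suc n ℕ.+ 1 ℕ.* suc n) ℕ.* suc n
    lem = trans (sym (ℕ.*-assoc (suc j) (suc n) (suc n)))
      (cong (ℕ._* suc n) (trans (cong (ℕ._* suc n) (ℕ.+-comm 1 j)) (ℕ.*-distribʳ-+ (suc n) j 1)))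
    lemℤ : + suc j ℤ.* + (suc n ℕ.* suc n) ≡ (+ j ℤ.* + suc n ℤ.+ + 1 ℤ.* + suc n) ℤ.* + suc n
    lemℤ = trans (sym (ℤ.pos-* (suc j) (suc n ℕ.* suc n)))
      (trans (cong +_ lem) (trans (ℤ.pos-* (j ℕ.* suc n ℕ.+ 1 ℕ.* suc n) (suc n))
        (cong (ℤ._* + suc n) (trans (ℤ.pos-+ (j ℕ.* suc n) (1 ℕ.* suc n))
          (cong₂ ℤ._+_ (ℤ.pos-* j (suc n)) (ℤ.pos-* 1 (suc n)))))))

  search-bound : ∀ n q → 0ℚ ℚ.≤ q → q ℚ.< grid n (suc n ℕ.* suc ℤ.∣ ℚ.ℚ.numerator q ∣)
  search-bound n (mkℚ -[1+ a ] d _) (ℚ.*≤* ())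
  search-bound n q@(mkℚ (+ a) d _) _ = ℚ.toℚᵘ-cancel-< (ℚᵘ.<-≤-trans
    (ℚᵘ.*<* (ℤ.≤-<-trans (ℤ.≤-reflexive (sym (ℤ.pos-* a (suc n))))
      (ℤ.<-≤-trans (ℤ.+<+ lem) (ℤ.≤-reflexive (ℤ.pos-* (suc n ℕ.* suc a) (suc d))))))
    (ℚᵘ.≤-reflexive (ℚᵘ.≃-sym (grid-toℚᵘ n (suc n ℕ.* suc a)))))
    where
    lem : a ℕ.* suc n ℕ.< suc n ℕ.* suc a ℕ.* suc d
    lem = ℕ.≤-<-trans (ℕ.≤-reflexive (ℕ.*-comm a (suc n)))
      (ℕ.<-≤-trans (ℕ.*-monoʳ-< (suc n) (ℕ.n<1+n a)) (ℕ.m≤m*n (suc n ℕ.* suc a) (suc d)))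

  1≤grid : ∀ n a → 1ℚ ℚ.≤ grid n (suc n ℕ.* suc a)
  1≤grid n a = ℚ.toℚᵘ-cancel-≤ (ℚᵘ.≤-trans
    (ℚᵘ.*≤* (ℤ.≤-trans (ℤ.≤-reflexive (ℤ.*-identityˡ (+ suc n)))
      (ℤ.≤-trans (ℤ.+≤+ (ℕ.m≤m*n (suc n) (suc a)))
        (ℤ.≤-reflexive (sym (ℤ.*-identityʳ (+ (suc n ℕ.* suc a))))))))
    (ℚᵘ.≤-reflexive (ℚᵘ.≃-sym (grid-toℚᵘ n (suc n ℕ.* suc a)))))

  archimedean : ∀ {ε} → 0ℚ ℚ.< ε → ∃ λ N → ∀ n → N ℕ.≤ n → grid n 1 ℚ.≤ ε
  archimedean {mkℚ (+ zero)  d _} (ℚ.*<* (ℤ.+<+ ()))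
  archimedean {mkℚ -[1+ a ]  d _} (ℚ.*<* ())
  archimedean {mkℚ (+ suc a) d _} _ = suc d , λ n N≤n → ℚ.toℚᵘ-cancel-≤ (ℚᵘ.≤-trans
    (ℚᵘ.≤-reflexive (grid-toℚᵘ n 1))
    (ℚᵘ.*≤* (ℤ.≤-trans (ℤ.≤-reflexive (ℤ.*-identityˡ (+ suc d)))
      (ℤ.≤-trans (ℤ.+≤+ (ℕ.≤-trans N≤n (ℕ.≤-trans (ℕ.n≤1+n n) (ℕ.m≤n*m (suc n) (suc a)))))
        (ℤ.≤-reflexive (ℤ.pos-* (suc a) (suc n)))))))

opaque

  -- The largest multiple r of 1/(n+1) with rᵏ ≤ max(q,0); it is searched for
  -- among the multiples that are at most |numerator of max(q,0)| + 1.
  rootℚ : ℕ → ℕ → ℚ → ℚ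
  rootℚ k n q =
    grid n (greatest (λ j → grid n j ^ℚ k ℚ.≤? q ℚ.⊔ 0ℚ)
                     (suc n ℕ.* suc ℤ.∣ ℚ.ℚ.numerator (q ℚ.⊔ 0ℚ) ∣))

  rootℚ-nonneg : ∀ k n q → 0ℚ ℚ.≤ rootℚ k n q
  rootℚ-nonneg k n q = grid-nonneg n (greatest (λ j → grid n j ^ℚ k ℚ.≤? q ℚ.⊔ 0ℚ)
    (suc n ℕ.* suc ℤ.∣ ℚ.ℚ.numerator (q ℚ.⊔ 0ℚ) ∣))

  rootℚ-spec : ∀ k n q .{{_ : NonZero k}} →
    rootℚ k n q ^ℚ k ℚ.≤ q ℚ.⊔ 0ℚ × q ℚ.⊔ 0ℚ ℚ.< (rootℚ k n q ℚ.+ grid n 1) ^ℚ k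
  rootℚ-spec zero n q = contradiction refl (ℕ.≢-nonZero⁻¹ 0)
  rootℚ-spec k@(suc k-1) n q =
    proj₁ spec , subst (λ g → q⁺ ℚ.< g ^ℚ k) (grid-suc n r) (ℚ.≰⇒> (proj₂ spec))
    where
    q⁺ : ℚ
    q⁺ = q ℚ.⊔ 0ℚ
    a : ℕ
    a = ℤ.∣ ℚ.ℚ.numerator q⁺ ∣
    P : ℕ → Set
    P j = grid n j ^ℚ k ℚ.≤ q⁺
    P? : Decidable P
    P? j = grid n j ^ℚ k ℚ.≤? q⁺
    r : ℕ
    r = greatest P? (suc n ℕ.* suc a)
    0≤q⁺ : 0ℚ ℚ.≤ q⁺
    0≤q⁺ = ℚ.p≤q⊔p q 0ℚ
    p₀ : P 0
    p₀ = subst (λ g → g ^ℚ k ℚ.≤ q⁺) (sym (grid-zero n))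
      (subst (ℚ._≤ q⁺) (sym (ℚ.*-zeroˡ (0ℚ ^ℚ k-1))) 0≤q⁺)
    ¬p : ¬ P (suc n ℕ.* suc a)
    ¬p p = ℚ.<-irrefl refl (ℚ.<-≤-trans (search-bound n q⁺ 0≤q⁺)
      (ℚ.≤-trans (≤-^suc (grid n (suc n ℕ.* suc a)) k-1 (1≤grid n a)) p))
    spec : P r × ¬ P (suc r)
    spec = greatest-spec P? (suc n ℕ.* suc a) p₀ ¬p

rootℚ-close : ∀ k .{{_ : NonZero k}} m n p q η → 0ℚ ℚ.≤ η → grid n 1 ℚ.≤ η →
  p ℚ.≤ q ℚ.+ η ^ℚ k → rootℚ k m p ℚ.≤ rootℚ k n q ℚ.+ (η ℚ.+ η)
rootℚ-close zero m n p q η _ _ _ = contradiction refl (ℕ.≢-nonZero⁻¹ 0)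
rootℚ-close k@(suc k-1) m n p q η 0≤η g≤η p≤q+ηᵏ = ℚ.≮⇒≥ λ r+2η<s →
  ℚ.<-irrefl {q ℚ.⊔ 0ℚ ℚ.+ η ^ℚ k} refl (begin-strict
    q ℚ.⊔ 0ℚ ℚ.+ η ^ℚ k
      <⟨ ℚ.+-monoˡ-< (η ^ℚ k) (proj₂ (rootℚ-spec k n q)) ⟩
    (r ℚ.+ g) ^ℚ k ℚ.+ η ^ℚ k
      ≤⟨ ℚ.+-monoˡ-≤ (η ^ℚ k) (^-mono-≤ (r ℚ.+ g) (r ℚ.+ η) k 0≤r+g (ℚ.+-monoʳ-≤ r g≤η)) ⟩
    (r ℚ.+ η) ^ℚ k ℚ.+ η ^ℚ k
      ≤⟨ ^-superadditive (r ℚ.+ η) η k-1 0≤r+η 0≤η ⟩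
    (r ℚ.+ η ℚ.+ η) ^ℚ k
      ≡⟨ cong (_^ℚ k) (ℚ.+-assoc r η η) ⟩
    (r ℚ.+ (η ℚ.+ η)) ^ℚ k
      ≤⟨ ^-mono-≤ (r ℚ.+ (η ℚ.+ η)) s k 0≤r+2η (ℚ.<⇒≤ r+2η<s) ⟩
    s ^ℚ k
      ≤⟨ proj₁ (rootℚ-spec k m p) ⟩
    p ℚ.⊔ 0ℚ
      ≤⟨ ⊔-close p 0ℚ q 0ℚ (η ^ℚ k) p≤q+ηᵏ 0≤0+ηᵏ ⟩
    q ℚ.⊔ 0ℚ ℚ.+ η ^ℚ k ∎)
  where
  r = rootℚ k n q
  s = rootℚ k m p
  g = grid n 1
  0≤r    = rootℚ-nonneg k n q
  0≤r+g  = +-nonneg r g 0≤r (grid-nonneg n 1)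
  0≤r+η  = +-nonneg r η 0≤r 0≤η
  0≤r+2η = +-nonneg r (η ℚ.+ η) 0≤r (+-nonneg η η 0≤η 0≤η)
  0≤0+ηᵏ : 0ℚ ℚ.≤ 0ℚ ℚ.+ η ^ℚ k
  0≤0+ηᵏ = subst (0ℚ ℚ.≤_) (sym (ℚ.+-identityˡ (η ^ℚ k))) (^-nonneg η k 0≤η)

opaque

  root-cauchy : ∀ k .{{_ : NonZero k}} s → IsCauchy s → IsCauchy (λ n → rootℚ k n (s n))
  root-cauchy k s c ε 0<ε =
    let η     = ½ ℚ.* ε
        0<η   = half-pos 0<ε
        M , f = archimedean 0<η
        N , g = c (η ^ℚ k) (^-pos η k 0<η)
    in M ℕ.⊔ N , λ i j p q →
      let gij = g i j (ℕ.m⊔n≤o⇒n≤o M N p) (ℕ.m⊔n≤o⇒n≤o M N q)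
          a   = rootℚ k i (s i)
          b   = rootℚ k j (s j)
      in subst (ℚ.∣ a ℚ.- b ∣ ℚ.≤_) (half+half ε) (unclose a b (η ℚ.+ η)
        (rootℚ-close k i j (s i) (s j) η (ℚ.<⇒≤ 0<η) (f j (ℕ.m⊔n≤o⇒m≤o M N q)) (close (s i) (s j) gij))
        (rootℚ-close k j i (s j) (s i) η (ℚ.<⇒≤ 0<η) (f i (ℕ.m⊔n≤o⇒m≤o M N p)) (close′ (s i) (s j) gij)))

-- The k-th root of max(x,0), hence of x when x is nonnegative.
root : (k : ℕ) .{{_ : NonZero k}} → ℝ → ℝ
root k x = mkℝ (λ n → rootℚ k n (seq x n)) (root-cauchy k (seq x) (cauchy x))

infix 8 _^[_/_]

_^[_/_] : ℝ → ℕ → (q : ℕ) .{{_ : NonZero q}} → ℝ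
x ^[ p / q ] = root q x ^ p

------------------------------------------------------------------------
-- Complex numbers

record ℂ : Set where
  constructor mkℂ
  field
    re im : ℝ

open ℂ public

0ℂ : ℂ
0ℂ = mkℂ 0ℝ 0ℝ

infixl 6 _+ᶜ_
infixl 7 _*ᶜ_

_+ᶜ_ : ℂ → ℂ → ℂ
mkℂ a b +ᶜ mkℂ c d = mkℂ (a + c) (b + d)

_*ᶜ_ : ℂ → ℂ → ℂ
mkℂ a b *ᶜ mkℂ c d = mkℂ (a * c - b * d) (a * d + b * c)

conj : ℂ → ℂ
conj (mkℂ a b) = mkℂ a (- b)

∣_∣ᶜ : ℂ → ℝ
∣ mkℂ a b ∣ᶜ = root 2 (a ^ 2 + b ^ 2)

------------------------------------------------------------------------
-- The group ℤ/mℤ, on representatives 0, …, m-1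

ℤ/ : ℕ → Set
ℤ/ m = Fin m

module _ {m : ℕ} .{{_ : NonZero m}} where

  reduce : ℤ → ℤ/ m
  reduce k = fromℕ< (ℤ.n%ℕd<d k m)

  _⊕_ : ℤ/ m → ℤ/ m → ℤ/ m
  x ⊕ y = reduce (+ toℕ x ℤ.+ + toℕ y)

  -- I is the reduction of {k ∈ ℤ : a ≤ k < b}; it is empty when b ≤ a.
  IsInterval : Subset m → Set
  IsInterval I = ∃ λ (a : ℤ) → ∃ λ (b : ℤ) →
    (∀ {k l} → a ℤ.≤ k → k ℤ.< b → a ℤ.≤ l → l ℤ.< b → reduce k ≡ reduce l → k ≡ l) ×
    (∀ x → x ∈ I ⇔ ∃ λ k → a ℤ.≤ k × k ℤ.< b × reduce k ≡ x)

elements : ∀ {m} → Subset m → List (Fin m)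
elements B = filter (_∈? B) (allFin _)

------------------------------------------------------------------------
-- Sums, norms and correlations

S : ∀ {m} → (ℤ/ m → ℂ) → Subset m → ℂ
S φ B = foldr _+ᶜ_ 0ℂ (map φ (elements B))

-- Starting the maximum from 0 is harmless for the nonnegative functions below,
-- and makes the maximum over the empty set 0.
maxOver : ∀ {m} → Subset m → (ℤ/ m → ℝ) → ℝ
maxOver B f = foldr _⊔_ 0ℝ (map f (elements B))

‖_‖∞ : ∀ {m} → (ℤ/ m → ℂ) → ℝ
‖ φ ‖∞ = maxOver ⊤ λ x → ∣ φ x ∣ᶜ

‖_‖₂ : ∀ {m} → (ℤ/ m → ℂ) → ℝ
‖_‖₂ {m} φ = foldr _+_ 0ℝ (map (λ x → ∣ φ x ∣ᶜ ^ 2) (elements {m} ⊤)) ^[ 1 / 2 ]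

𝒞 : ∀ {m} .{{_ : NonZero m}} → (ℤ/ m → ℂ) → ℤ/ m → ℂ
𝒞 φ a = S (λ x → φ x *ᶜ conj (φ (x ⊕ a))) ⊤

{-# OPTIONS --safe #-}

-- For the translates X a of the sum over I, consecutive terms differ by
-- φ(x) - φ(y), hence by at most 2‖φ‖∞.  Starting from s = |S(φ;I)|, the
-- inequality s³ ≤ (s - h)³ + 3hs² with h = 2‖φ‖∞ telescopes along the translates
-- to s³ ≤ 6‖φ‖∞ Σ_a |X a|².  Expanding the squares gives the correlations
-- 𝒞(φ,k-j) over pairs of points of I: those in D contribute at most
-- |D||I|‖φ‖₂², the others at most |I|² max|𝒞|.  Since 6 ≤ 2³, taking cube roots,
-- which are subadditive, gives the theorem.
--
-- For reals given by Cauchy sequences, the argument runs on the rational n-th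
-- terms, where a root is known up to 1/(n+1); only the resulting inequality of
-- cubes is passed to the limit.

module Submission where

open import Defs
open import Algebra.Bundles using (CommutativeRing)
open import Data.Bool using (if_then_else_)
open import Data.Fin as Fin using (Fin; toℕ)
import Data.Fin.Properties as Fin
open import Data.Fin.Subset using (Subset; ∁; ∣_∣; inside; outside; ⊤) renaming (_∈_ to _∈ₛ_; _∉_ to _∉ₛ_)
open import Data.Fin.Subset.Properties using (_∈?_; ∈⊤; drop-there; x∉p⇒x∈∁p; ∣p∣≤n)
open import Data.Integer as ℤ using (ℤ; +_)
import Data.Integer.DivMod as ℤ
import Data.Integer.Properties as ℤ
import Data.Integer.Solver as ℤ
open import Data.List using (List; []; _∷_; foldr; map; filter; tabulate; allFin; applyUpTo; length)
open import Data.List.Membership.Propositional using (_∈_)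
open import Data.List.Membership.Propositional.Properties
  using (∈-filter⁺; ∈-filter⁻; ∈-allFin; ∈-applyUpTo⁺; ∈-applyUpTo⁻)
open import Data.List.Membership.Propositional.Properties.WithK using (unique∧set⇒bag)
open import Data.List.Properties using (filter-all; length-applyUpTo)
open import Data.List.Relation.Binary.BagAndSetEquality using (∼bag⇒↭)
open import Data.List.Relation.Binary.Permutation.Propositional using (_↭_; ↭⇒↭ₛ)
import Data.List.Relation.Binary.Permutation.Propositional.Properties as ↭
import Data.List.Relation.Binary.Permutation.Setoid.Properties as ↭ₛ
open import Data.List.Relation.Unary.All using (universal)
open import Data.List.Relation.Unary.Any using (here; there)
open import Data.List.Relation.Unary.Unique.Propositional.Properties using (filter⁺; allFin⁺; applyUpTo⁺₁)
open import Data.Nat as ℕ using (ℕ; zero; suc; NonZero; z≤n; s≤s)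
import Data.Nat.DivMod as ℕ
import Data.Nat.Properties as ℕ
open import Data.Nat.Tactic.RingSolver using (solve-∀)
open import Data.Product using (_×_; _,_; proj₁; proj₂; ∃; map₂)
open import Data.Rational as ℚ using (ℚ; 0ℚ; 1ℚ; ½; _/_)
import Data.Rational.Properties as ℚ
open import Data.Rational.Solver using (module +-*-Solver)
open import Data.Sum using (inj₁; inj₂)
open import Data.Vec using (_∷_; []; here; there)
open import Function using (_∘_; id; _⇔_; mk⇔; Equivalence)
open import Relation.Binary.PropositionalEquality
open import Relation.Nullary using (yes; no; contradiction; does)

open import Algebra.Definitions.RawSemiring ℚ.+-*-rawSemiring using () renaming (_^_ to _^ℚ_)
open import Algebra.Properties.AbelianGroup ℤ.+-0-abelianGroup using () renaming (∙-cancelˡ to ℤ-+-cancelˡ)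
open import Algebra.Properties.Group ℚ.+-0-group using () renaming (∙-cancelˡ to ℚ-+-cancelˡ)
open import Algebra.Properties.Semiring.Sum (CommutativeRing.semiring ℚ.+-*-commutativeRing)
  using (sum; sum-syntax; sum-cong-≗; ∑-comm; ∑-distrib-+; *-distribˡ-sum; *-distribʳ-sum)

open Equivalence using (to; from)

-- Intervals in ℤ/mℤ

elements-⊤ : ∀ m → elements {m} ⊤ ≡ allFin m
elements-⊤ m = filter-all (_∈? ⊤) (universal (λ _ → ∈⊤) (allFin m))

∈-elements : ∀ {m} {B : Subset m} {x} → x ∈ elements B ⇔ x ∈ₛ B
∈-elements {m} {B} {x} = mk⇔ (proj₂ ∘ ∈-filter⁻ (_∈? B) {xs = allFin m}) (∈-filter⁺ (_∈? B) (∈-allFin x))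

length-elements : ∀ {m} (B : Subset m) → length (elements B) ≡ ∣ B ∣
length-elements B = go B id (mk⇔ id id)
  where
  -- Generalised over `g` because the tail of the list is tabulated along `Fin.suc` while the
  -- membership test still refers to the fixed `B`.
  go : ∀ {n} (p : Subset n) (g : Fin n → Fin _) → (∀ {i} → g i ∈ₛ B ⇔ i ∈ₛ p) →
       length (filter (_∈? B) (tabulate g)) ≡ ∣ p ∣
  go []            g h = refl
  go (inside ∷ p)  g h with g Fin.zero ∈? B
  ... | yes _  = cong suc (go p (g ∘ Fin.suc) (mk⇔ (drop-there ∘ to h) (from h ∘ there)))
  ... | no ∉B  = contradiction (from h here) ∉B
  go (outside ∷ p) g h with g Fin.zero ∈? B
  ... | yes ∈B = contradiction (to h ∈B) λ()
  ... | no _   = go p (g ∘ Fin.suc) (mk⇔ (drop-there ∘ to h) (from h ∘ there))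

module _ {m : ℕ} .{{_ : NonZero m}} where

  -- The two remainders differ by a multiple `z * m`, but both lie between 0 and m - 1, so
  -- `∣ z ∣ * m < m` and `z` vanishes.
  %ℕ-unique : ∀ i j q → i ≡ j ℤ.+ q ℤ.* + m → i ℤ.%ℕ m ≡ j ℤ.%ℕ m
  %ℕ-unique i j q eq = ℤ.+-injective (ℤ.i-j≡0⇒i≡j (+ r) (+ s) (trans r-s≡zm
    (cong (ℤ._* + m) (ℤ.∣i∣≡0⇒i≡0 {z} ∣z∣≡0))))
    where
    open ℤ.+-*-Solver
    r = i ℤ.%ℕ m
    s = j ℤ.%ℕ m
    z = q ℤ.+ j ℤ./ℕ m ℤ.- i ℤ./ℕ m
    r-s≡zm : + r ℤ.- + s ≡ z ℤ.* + m
    r-s≡zm = begin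
      + r ℤ.- + s
        ≡⟨ solve 4 (λ r s a b → r :- s := r :+ a :- (s :+ b) :+ (b :- a)) refl (+ r) (+ s) (i ℤ./ℕ m ℤ.* + m) (j ℤ./ℕ m ℤ.* + m) ⟩
      + r ℤ.+ i ℤ./ℕ m ℤ.* + m ℤ.- (+ s ℤ.+ j ℤ./ℕ m ℤ.* + m) ℤ.+ (j ℤ./ℕ m ℤ.* + m ℤ.- i ℤ./ℕ m ℤ.* + m)
        ≡⟨ cong₂ (λ x y → x ℤ.- y ℤ.+ (j ℤ./ℕ m ℤ.* + m ℤ.- i ℤ./ℕ m ℤ.* + m)) (ℤ.a≡a%ℕn+[a/ℕn]*n i m) (ℤ.a≡a%ℕn+[a/ℕn]*n j m) ⟨
      i ℤ.- j ℤ.+ (j ℤ./ℕ m ℤ.* + m ℤ.- i ℤ./ℕ m ℤ.* + m)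
        ≡⟨ cong (λ x → x ℤ.- j ℤ.+ (j ℤ./ℕ m ℤ.* + m ℤ.- i ℤ./ℕ m ℤ.* + m)) eq ⟩
      j ℤ.+ q ℤ.* + m ℤ.- j ℤ.+ (j ℤ./ℕ m ℤ.* + m ℤ.- i ℤ./ℕ m ℤ.* + m)
        ≡⟨ solve 5 (λ j q m a b → j :+ q :* m :- j :+ (b :* m :- a :* m) := (q :+ b :- a) :* m) refl j q (+ m) (i ℤ./ℕ m) (j ℤ./ℕ m) ⟩
      z ℤ.* + m ∎
      where open ≡-Reasoning
    ∣z∣≡0 : ℤ.∣ z ∣ ≡ 0
    ∣z∣≡0 = ℕ.n<1⇒n≡0 (ℕ.*-cancelʳ-< m ℤ.∣ z ∣ 1 (begin-strict
      ℤ.∣ z ∣ ℕ.* m        ≡⟨ ℤ.abs-* z (+ m) ⟨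
      ℤ.∣ z ℤ.* + m ∣      ≡⟨ cong ℤ.∣_∣ r-s≡zm ⟨
      ℤ.∣ + r ℤ.- + s ∣    ≡⟨ cong ℤ.∣_∣ (ℤ.[+m]-[+n]≡m⊖n r s) ⟩
      ℤ.∣ r ℤ.⊖ s ∣        ≤⟨ ℤ.∣m⊝n∣≤m⊔n r s ⟩
      r ℕ.⊔ s              <⟨ ℕ.⊔-lub (ℤ.n%ℕd<d i m) (ℤ.n%ℕd<d j m) ⟩
      m                    ≡⟨ ℕ.*-identityˡ m ⟨
      1 ℕ.* m              ∎))
      where open ℕ.≤-Reasoning

  reduce-cong : ∀ i j q → i ≡ j ℤ.+ q ℤ.* + m → reduce i ≡ reduce j
  reduce-cong i j q eq = Fin.fromℕ<-cong _ _ (%ℕ-unique i j q eq) _ _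

  residue : ℕ → ℤ/ m
  residue i = reduce (+ i)

  residue-periodic : ∀ i → residue (i ℕ.+ m) ≡ residue i
  residue-periodic i = Fin.fromℕ<-cong _ _ (ℕ.[m+n]%n≡m%n i m) _ _

  residue-toℕ : ∀ (x : ℤ/ m) → residue (toℕ x) ≡ x
  residue-toℕ x = trans (Fin.fromℕ<-cong _ _ (ℕ.m<n⇒m%n≡m (Fin.toℕ<n x)) _ (Fin.toℕ<n x))
                        (Fin.fromℕ<-toℕ x (Fin.toℕ<n x))

  ⊕-residue : ∀ (x : ℤ/ m) d → x ⊕ residue d ≡ residue (toℕ x ℕ.+ d)
  ⊕-residue x d = Fin.fromℕ<-cong _ _ (begin
    (toℕ x ℕ.+ toℕ (residue d)) ℕ.% m           ≡⟨ cong (λ r → (toℕ x ℕ.+ r) ℕ.% m) (Fin.toℕ-fromℕ< _) ⟩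
    (toℕ x ℕ.+ d ℕ.% m) ℕ.% m                   ≡⟨ ℕ.%-distribˡ-+ (toℕ x) (d ℕ.% m) m ⟩
    (toℕ x ℕ.% m ℕ.+ d ℕ.% m ℕ.% m) ℕ.% m       ≡⟨ cong (λ r → (toℕ x ℕ.% m ℕ.+ r) ℕ.% m) (ℕ.m%n%n≡m%n d m) ⟩
    (toℕ x ℕ.% m ℕ.+ d ℕ.% m) ℕ.% m             ≡⟨ ℕ.%-distribˡ-+ (toℕ x) d m ⟨
    (toℕ x ℕ.+ d) ℕ.% m                         ∎) _ _
    where open ≡-Reasoning

  -- Replaces an integer starting point by its remainder, so that an interval can be indexed by
  -- natural numbers.
  reduce-+ : ∀ a j → reduce (a ℤ.+ + j) ≡ residue (a ℤ.%ℕ m ℕ.+ j)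
  reduce-+ a j = reduce-cong (a ℤ.+ + j) (+ (a ℤ.%ℕ m ℕ.+ j)) (a ℤ./ℕ m) (begin
    a ℤ.+ + j                                     ≡⟨ cong (ℤ._+ + j) (ℤ.a≡a%ℕn+[a/ℕn]*n a m) ⟩
    + (a ℤ.%ℕ m) ℤ.+ a ℤ./ℕ m ℤ.* + m ℤ.+ + j     ≡⟨ solve 3 (λ r q j → r :+ q :+ j := r :+ j :+ q) refl (+ (a ℤ.%ℕ m)) (a ℤ./ℕ m ℤ.* + m) (+ j) ⟩
    + (a ℤ.%ℕ m) ℤ.+ + j ℤ.+ a ℤ./ℕ m ℤ.* + m     ∎)
    where
    open ≡-Reasoning
    open ℤ.+-*-Solver

  interval-length : ∀ (a b : ℤ) → ∃ λ L → (∀ {j} → j ℕ.< L → a ℤ.+ + j ℤ.< b) ×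
                    (∀ {k} → a ℤ.≤ k → k ℤ.< b → ∃ λ j → j ℕ.< L × k ≡ a ℤ.+ + j)
  interval-length a b with ℤ.≤-total a b
  -- The empty range: its length is 0 and not `∣ b - a ∣`, which is positive when b < a.
  ... | inj₂ b≤a = 0 , (λ ()) , λ a≤k k<b →
    contradiction (ℤ.<-≤-trans k<b (ℤ.≤-trans b≤a a≤k)) (ℤ.<-irrefl refl)
  ... | inj₁ a≤b = ℤ.∣ b ℤ.- a ∣
    , (λ {j} j<L → subst (a ℤ.+ + j ℤ.<_) (difference a≤b) (ℤ.+-monoʳ-< a (ℤ.+<+ j<L)))
    , λ {k} a≤k k<b → ℤ.∣ k ℤ.- a ∣
      , ℤ.drop‿+<+ (subst₂ ℤ._<_ (sym (ℤ.0≤i⇒+∣i∣≡i (ℤ.i≤j⇒0≤j-i a≤k)))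
                                 (sym (ℤ.0≤i⇒+∣i∣≡i (ℤ.i≤j⇒0≤j-i a≤b))) (ℤ.+-monoˡ-< (ℤ.- a) k<b))
      , sym (difference a≤k)
    where
    difference : ∀ {k} → a ℤ.≤ k → a ℤ.+ + ℤ.∣ k ℤ.- a ∣ ≡ k
    difference {k} a≤k = trans (cong (ℤ._+_ a) (ℤ.0≤i⇒+∣i∣≡i (ℤ.i≤j⇒0≤j-i a≤k)))
      (solve 2 (λ a k → a :+ (k :- a) := k) refl a k)
      where open ℤ.+-*-Solver

  -- Both lists are free of repetitions and have the same members, hence agree as bags. For the list
  -- of residues, freedom from repetitions is the injectivity of reduction on the interval.
  -- Comparing lengths afterwards identifies the number of integers with `∣ I ∣`.
  interval-elements : ∀ {I : Subset m} → IsInterval I →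
    ∃ λ lo → elements I ↭ applyUpTo (λ j → residue (lo ℕ.+ j)) ∣ I ∣
  interval-elements {I} (a , b , inj , I⇔) =
    a ℤ.%ℕ m , subst (λ n → elements I ↭ applyUpTo g n) L≡∣I∣ perm
    where
    g : ℕ → ℤ/ m
    g j = residue (a ℤ.%ℕ m ℕ.+ j)
    L = proj₁ (interval-length a b)
    below = proj₁ (proj₂ (interval-length a b))
    index = proj₂ (proj₂ (interval-length a b))
    above : ∀ j → a ℤ.≤ a ℤ.+ + j
    above j = ℤ.i≤i+j a (+ j)
    distinct : ∀ {i j} → i ℕ.< j → j ℕ.< L → g i ≢ g j
    distinct {i} {j} i<j j<L gi≡gj = ℕ.<⇒≢ i<j (ℤ.+-injective (ℤ-+-cancelˡ a _ _
      (inj (above i) (below (ℕ.<-trans i<j j<L)) (above j) (below j<L)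
        (trans (reduce-+ a i) (trans gi≡gj (sym (reduce-+ a j)))))))
    to-range : ∀ {x} → x ∈ elements I → x ∈ applyUpTo g L
    to-range x∈ with to (I⇔ _) (to ∈-elements x∈)
    ... | k , a≤k , k<b , refl with index a≤k k<b
    ...   | j , j<L , refl = subst (_∈ applyUpTo g L) (sym (reduce-+ a j)) (∈-applyUpTo⁺ g j<L)
    from-range : ∀ {x} → x ∈ applyUpTo g L → x ∈ elements I
    from-range x∈ with ∈-applyUpTo⁻ g x∈
    ... | j , j<L , refl = from ∈-elements (from (I⇔ _) (a ℤ.+ + j , above j , below j<L , reduce-+ a j))
    perm : elements I ↭ applyUpTo g L
    perm = ∼bag⇒↭ (unique∧set⇒bag (filter⁺ (_∈? I) (allFin⁺ m)) (applyUpTo⁺₁ g L distinct)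
      (mk⇔ to-range from-range))
    L≡∣I∣ : L ≡ ∣ I ∣
    L≡∣I∣ = trans (sym (length-applyUpTo g L)) (trans (sym (↭.↭-length perm)) (length-elements I))

open +-*-Solver
open ℚ.≤-Reasoning

-- Rational points of the plane

ℚ² : Set
ℚ² = ℚ × ℚ

infixl 6 _⊞_ _⊟_
infixl 11 _∙_

_⊞_ _⊟_ : ℚ² → ℚ² → ℚ²
(a , b) ⊞ (c , d) = a ℚ.+ c , b ℚ.+ d
(a , b) ⊟ (c , d) = a ℚ.- c , b ℚ.- d

_∙_ : ℚ² → ℚ² → ℚ
(a , b) ∙ (c , d) = a ℚ.* c ℚ.+ b ℚ.* d

-- The modulus of a rational point need not be rational, so a bound by A ≥ 0 on the modulus is
-- always written `‖ z ‖² ≤ A * A`.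
‖_‖² : ℚ² → ℚ
‖ z ‖² = z ∙ z

-- Reduces a polynomial inequality to an identity, which `solve` can check, and the nonnegativity of
-- an explicit difference.
≤-from-diff : ∀ {p q} d → 0ℚ ℚ.≤ d → q ≡ p ℚ.+ d → p ℚ.≤ q
≤-from-diff {p} {q} d 0≤d eq = begin
  p            ≡⟨ ℚ.+-identityʳ p ⟨
  p ℚ.+ 0ℚ     ≤⟨ ℚ.+-monoʳ-≤ p 0≤d ⟩
  p ℚ.+ d      ≡⟨ eq ⟨
  q            ∎

sq-nonneg : ∀ p → 0ℚ ℚ.≤ p ℚ.* p
sq-nonneg p with ℚ.≤-total 0ℚ p
... | inj₁ 0≤p = *-nonneg p p 0≤p 0≤p
... | inj₂ p≤0 = subst (0ℚ ℚ.≤_) (solve 1 (λ p → :- p :* :- p := p :* p) refl p)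
                   (*-nonneg (ℚ.- p) (ℚ.- p) (ℚ.neg-antimono-≤ p≤0) (ℚ.neg-antimono-≤ p≤0))

sq-mono-< : ∀ {p q} → 0ℚ ℚ.≤ p → p ℚ.< q → p ℚ.* p ℚ.< q ℚ.* q
sq-mono-< {p} {q} 0≤p p<q = begin-strict
  p ℚ.* p  ≤⟨ ℚ.*-monoˡ-≤-nonNeg p {{ℚ.nonNegative 0≤p}} (ℚ.<⇒≤ p<q) ⟩
  p ℚ.* q  <⟨ ℚ.*-monoˡ-<-pos q {{ℚ.positive (ℚ.≤-<-trans 0≤p p<q)}} p<q ⟩
  q ℚ.* q  ∎

sq-cancel-≤ : ∀ {p q} → 0ℚ ℚ.≤ q → p ℚ.* p ℚ.≤ q ℚ.* q → p ℚ.≤ q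
sq-cancel-≤ 0≤q pp≤qq = ℚ.≮⇒≥ λ q<p → ℚ.<-irrefl refl (ℚ.<-≤-trans (sq-mono-< 0≤q q<p) pp≤qq)

‖‖²-nonneg : ∀ z → 0ℚ ℚ.≤ ‖ z ‖²
‖‖²-nonneg (a , b) = +-nonneg (a ℚ.* a) (b ℚ.* b) (sq-nonneg a) (sq-nonneg b)

-- Cauchy-Schwarz, from Lagrange's identity: `‖ z ‖² * ‖ w ‖²` exceeds the square of `z ∙ w` by the
-- square of the determinant.
∙-bound : ∀ z w {A B} → 0ℚ ℚ.≤ A → 0ℚ ℚ.≤ B →
          ‖ z ‖² ℚ.≤ A ℚ.* A → ‖ w ‖² ℚ.≤ B ℚ.* B → z ∙ w ℚ.≤ A ℚ.* B
∙-bound z@(a , b) w@(c , d) {A} {B} 0≤A 0≤B z≤A w≤B = sq-cancel-≤ (*-nonneg A B 0≤A 0≤B) (begin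
  z ∙ w ℚ.* z ∙ w
    ≤⟨ ≤-from-diff ((a ℚ.* d ℚ.- b ℚ.* c) ℚ.* (a ℚ.* d ℚ.- b ℚ.* c)) (sq-nonneg (a ℚ.* d ℚ.- b ℚ.* c))
         (solve 4 (λ a b c d → (a :* a :+ b :* b) :* (c :* c :+ d :* d) :=
            (a :* c :+ b :* d) :* (a :* c :+ b :* d) :+ (a :* d :- b :* c) :* (a :* d :- b :* c)) refl a b c d) ⟩
  ‖ z ‖² ℚ.* ‖ w ‖²
    ≤⟨ *-mono-≤ _ _ _ _ (‖‖²-nonneg z) (sq-nonneg B) z≤A w≤B ⟩
  (A ℚ.* A) ℚ.* (B ℚ.* B)
    ≡⟨ solve 2 (λ A B → (A :* A) :* (B :* B) := (A :* B) :* (A :* B)) refl A B ⟩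
  (A ℚ.* B) ℚ.* (A ℚ.* B) ∎)

‖⊞‖² : ∀ z w → ‖ z ⊞ w ‖² ≡ ‖ z ‖² ℚ.+ ‖ w ‖² ℚ.+ (z ∙ w ℚ.+ z ∙ w)
‖⊞‖² (a , b) (c , d) = solve 4 (λ a b c d →
  (a :+ c) :* (a :+ c) :+ (b :+ d) :* (b :+ d) :=
  (a :* a :+ b :* b) :+ (c :* c :+ d :* d) :+ ((a :* c :+ b :* d) :+ (a :* c :+ b :* d))) refl a b c d

square-of-sum : ∀ A B → A ℚ.* A ℚ.+ B ℚ.* B ℚ.+ (A ℚ.* B ℚ.+ A ℚ.* B) ≡ (A ℚ.+ B) ℚ.* (A ℚ.+ B)
square-of-sum = solve 2 (λ A B → A :* A :+ B :* B :+ (A :* B :+ A :* B) := (A :+ B) :* (A :+ B)) refl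

triangle : ∀ z w {A B} → 0ℚ ℚ.≤ A → 0ℚ ℚ.≤ B → ‖ z ‖² ℚ.≤ A ℚ.* A → ‖ w ‖² ℚ.≤ B ℚ.* B →
           ‖ z ⊞ w ‖² ℚ.≤ (A ℚ.+ B) ℚ.* (A ℚ.+ B)
triangle z w {A} {B} 0≤A 0≤B z≤A w≤B = begin
  ‖ z ⊞ w ‖²                                         ≡⟨ ‖⊞‖² z w ⟩
  ‖ z ‖² ℚ.+ ‖ w ‖² ℚ.+ (z ∙ w ℚ.+ z ∙ w)              ≤⟨ ℚ.+-mono-≤ (ℚ.+-mono-≤ z≤A w≤B) (ℚ.+-mono-≤ zw≤AB zw≤AB) ⟩
  A ℚ.* A ℚ.+ B ℚ.* B ℚ.+ (A ℚ.* B ℚ.+ A ℚ.* B)        ≡⟨ square-of-sum A B ⟩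
  (A ℚ.+ B) ℚ.* (A ℚ.+ B)                            ∎
  where zw≤AB = ∙-bound z w 0≤A 0≤B z≤A w≤B

-- If `‖ z ‖²` were below `A * A`, expanding the square of `z ⊞ (w ⊟ z)` and using Cauchy-Schwarz
-- would put `‖ w ‖²` strictly below `(A + B) * (A + B)`.
reverse-triangle : ∀ w z {A B} → 0ℚ ℚ.≤ A → 0ℚ ℚ.≤ B →
  (A ℚ.+ B) ℚ.* (A ℚ.+ B) ℚ.≤ ‖ w ‖² → ‖ w ⊟ z ‖² ℚ.≤ B ℚ.* B → A ℚ.* A ℚ.≤ ‖ z ‖²
reverse-triangle w@(a , b) z@(c , d) {A} {B} 0≤A 0≤B s≤w e≤B = ℚ.≮⇒≥ λ z<A → ℚ.<-irrefl refl (begin-strict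
  ‖ w ‖²                                                  ≡⟨ cong ‖_‖² (cong₂ _,_ (lem a c) (lem b d)) ⟩
  ‖ z ⊞ (w ⊟ z) ‖²                                        ≡⟨ ‖⊞‖² z (w ⊟ z) ⟩
  ‖ z ‖² ℚ.+ ‖ w ⊟ z ‖² ℚ.+ (z ∙ (w ⊟ z) ℚ.+ z ∙ (w ⊟ z))   <⟨ ℚ.+-mono-<-≤ (ℚ.+-mono-<-≤ z<A e≤B)
                                                             (ℚ.+-mono-≤ (zw≤AB z<A) (zw≤AB z<A)) ⟩
  A ℚ.* A ℚ.+ B ℚ.* B ℚ.+ (A ℚ.* B ℚ.+ A ℚ.* B)             ≡⟨ square-of-sum A B ⟩
  (A ℚ.+ B) ℚ.* (A ℚ.+ B)                                 ≤⟨ s≤w ⟩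
  ‖ w ‖²                                                  ∎)
  where
  lem : ∀ a b → a ≡ b ℚ.+ (a ℚ.- b)
  lem = solve 2 (λ a b → a := b :+ (a :- b)) refl
  zw≤AB : ‖ z ‖² ℚ.< A ℚ.* A → z ∙ (w ⊟ z) ℚ.≤ A ℚ.* B
  zw≤AB z<A = ∙-bound z (w ⊟ z) 0≤A 0≤B (ℚ.<⇒≤ z<A) e≤B

-- Finite sums

sum-mono : ∀ {n} {f g : Fin n → ℚ} → (∀ i → f i ℚ.≤ g i) → sum f ℚ.≤ sum g
sum-mono {zero}  f≤g = ℚ.≤-refl
sum-mono {suc n} f≤g = ℚ.+-mono-≤ (f≤g Fin.zero) (sum-mono (f≤g ∘ Fin.suc))

sum-nonneg : ∀ {n} {f : Fin n → ℚ} → (∀ i → 0ℚ ℚ.≤ f i) → 0ℚ ℚ.≤ sum f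
sum-nonneg {zero}  0≤f = ℚ.≤-refl
sum-nonneg {suc n} 0≤f = +-nonneg _ _ (0≤f Fin.zero) (sum-nonneg (0≤f ∘ Fin.suc))

sum-prefix : ∀ {k n} (f : ℕ → ℚ) → (∀ i → 0ℚ ℚ.≤ f i) → k ℕ.≤ n →
             ∑[ i < k ] f (toℕ i) ℚ.≤ ∑[ i < n ] f (toℕ i)
sum-prefix {n = n} f 0≤f z≤n = sum-nonneg {n} (0≤f ∘ toℕ)
sum-prefix f 0≤f (s≤s k≤n) = ℚ.+-monoʳ-≤ (f 0) (sum-prefix (f ∘ suc) (0≤f ∘ suc) k≤n)

sum-snoc : ∀ n (f : ℕ → ℚ) → ∑[ i < suc n ] f (toℕ i) ≡ ∑[ i < n ] f (toℕ i) ℚ.+ f n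
sum-snoc zero    f = ℚ.+-comm (f 0) 0ℚ
sum-snoc (suc n) f = trans (cong (f 0 ℚ.+_) (sum-snoc n (f ∘ suc))) (sym (ℚ.+-assoc (f 0) _ _))

-- Moving the starting point from `p` to `p + 1` trades the term `f p` for `f (p + m)`, which is
-- equal to it.
sum-rotate : ∀ m (f : ℕ → ℚ) → (∀ i → f (i ℕ.+ m) ≡ f i) → ∀ p →
             ∑[ i < m ] f (p ℕ.+ toℕ i) ≡ ∑[ i < m ] f (toℕ i)
sum-rotate m f per zero    = refl
sum-rotate m f per (suc p) = trans (ℚ-+-cancelˡ (f p) _ _ (begin-equality
  f p ℚ.+ ∑[ i < m ] f (suc p ℕ.+ toℕ i)
    ≡⟨ cong₂ ℚ._+_ (cong f (sym (ℕ.+-identityʳ p))) (sum-cong-≗ {m} (λ i → cong f (sym (ℕ.+-suc p (toℕ i))))) ⟩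
  ∑[ i < suc m ] f (p ℕ.+ toℕ i)
    ≡⟨ sum-snoc m (f ∘ (p ℕ.+_)) ⟩
  ∑[ i < m ] f (p ℕ.+ toℕ i) ℚ.+ f (p ℕ.+ m)
    ≡⟨ cong (∑[ i < m ] f (p ℕ.+ toℕ i) ℚ.+_) (per p) ⟩
  ∑[ i < m ] f (p ℕ.+ toℕ i) ℚ.+ f p
    ≡⟨ ℚ.+-comm _ (f p) ⟩
  f p ℚ.+ ∑[ i < m ] f (p ℕ.+ toℕ i) ∎)) (sum-rotate m f per p)

opaque
  unfolding grid

  -- A case of `grid-suc`, since `grid 0 n` unfolds to `+ n / 1`.
  /1-suc : ∀ n → + suc n ℚ./ 1 ≡ 1ℚ ℚ.+ (+ n ℚ./ 1)
  /1-suc n = trans (grid-suc 0 n) (ℚ.+-comm (+ n ℚ./ 1) 1ℚ)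

sum-const : ∀ n q → ∑[ i < n ] q ≡ (+ n ℚ./ 1) ℚ.* q
sum-const zero    q = sym (ℚ.*-zeroˡ q)
sum-const (suc n) q = trans (cong (q ℚ.+_) (sum-const n q)) (trans
  (solve 2 (λ q k → q :+ k :* q := (con 1ℚ :+ k) :* q) refl q (+ n ℚ./ 1)) (cong (ℚ._* q) (sym (/1-suc n))))

sumOver : ∀ {A : Set} → (A → ℚ) → List A → ℚ
sumOver f xs = foldr ℚ._+_ 0ℚ (map f xs)

sumOver-tabulate : ∀ {A : Set} {n} (f : A → ℚ) (g : Fin n → A) → sumOver f (tabulate g) ≡ ∑[ i < n ] f (g i)
sumOver-tabulate {n = zero}  f g = refl
sumOver-tabulate {n = suc n} f g = cong (f (g Fin.zero) ℚ.+_) (sumOver-tabulate f (g ∘ Fin.suc))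

sumOver-applyUpTo : ∀ {A : Set} (f : A → ℚ) (g : ℕ → A) n →
                    sumOver f (applyUpTo g n) ≡ ∑[ i < n ] f (g (toℕ i))
sumOver-applyUpTo f g zero    = refl
sumOver-applyUpTo f g (suc n) = cong (f (g 0) ℚ.+_) (sumOver-applyUpTo f (g ∘ suc) n)

sumOver-↭ : ∀ {A : Set} (f : A → ℚ) {xs ys} → xs ↭ ys → sumOver f xs ≡ sumOver f ys
sumOver-↭ f p = ↭ₛ.foldr-commMonoid (setoid ℚ) ℚ.+-0-isCommutativeMonoid (↭⇒↭ₛ (↭.map⁺ f p))

sumOver-⊤ : ∀ {m} (f : Fin m → ℚ) → sumOver f (elements ⊤) ≡ ∑[ x < m ] f x
sumOver-⊤ {m} f = trans (cong (sumOver f) (elements-⊤ m)) (sumOver-tabulate f id)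

indicator : ∀ {m} → Subset m → Fin m → ℚ
indicator B x = if does (x ∈? B) then 1ℚ else 0ℚ

indicator-nonneg : ∀ {m} (B : Subset m) x → 0ℚ ℚ.≤ indicator B x
indicator-nonneg B x with x ∈? B
... | yes _ = 0≤1
... | no _  = ℚ.≤-refl

sum-indicator : ∀ {m} (B : Subset m) → ∑[ x < m ] indicator B x ≡ + ∣ B ∣ ℚ./ 1
sum-indicator B = trans (go id) (cong (λ k → + k ℚ./ 1) (length-elements B))
  where
  go : ∀ {n} (g : Fin n → Fin _) →
       ∑[ i < n ] indicator B (g i) ≡ + length (filter (_∈? B) (tabulate g)) ℚ./ 1
  go {zero}  g = refl
  go {suc n} g with g Fin.zero ∈? B
  ... | yes _ = trans (cong (1ℚ ℚ.+_) (go (g ∘ Fin.suc))) 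
      (sym (/1-suc (length (filter (_∈? B) (tabulate (g ∘ Fin.suc))))))
  ... | no _  = trans (ℚ.+-identityˡ _) (go (g ∘ Fin.suc))

-- The sliding sum

infix 8 _³
_³ : ℚ → ℚ
p ³ = p ℚ.* (p ℚ.* p)

-- The product K h, written as a sum so that each step of `cube-descent` removes one summand.
multiple : ℕ → ℚ → ℚ
multiple K h = ∑[ a < K ] h

-- The sequence descends from ∣X 0∣ ≥ s in steps of size at most h, and
-- s³ ≤ (s - h)³ + 3hs² makes the cubes telescope.
cube-descent : ∀ (X : ℕ → ℚ²) h → 0ℚ ℚ.≤ h → (∀ a → ‖ X a ⊟ X (suc a) ‖² ℚ.≤ h ℚ.* h) →
  ∀ K s → 0ℚ ℚ.≤ s → s ℚ.* s ℚ.≤ ‖ X 0 ‖² → s ℚ.≤ multiple K h →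
  s ³ ℚ.≤ (h ℚ.+ h ℚ.+ h) ℚ.* ∑[ a < K ] ‖ X (toℕ a) ‖²
-- With no steps left, the bound on `s` by the empty multiple forces `s` to be 0.
cube-descent X h 0≤h steps zero s 0≤s _ s≤0 = ℚ.≤-reflexive (trans
  (cong _³ (ℚ.≤-antisym s≤0 0≤s)) (sym (ℚ.*-zeroʳ (h ℚ.+ h ℚ.+ h))))
cube-descent X h 0≤h steps (suc K) s 0≤s s≤X s≤Kh with ℚ.≤-total s h
-- The descent stops here: s³ ≤ h s², so the first term of the sum already suffices.
... | inj₁ s≤h = begin
  s ³
    ≤⟨ *-mono-≤ _ _ _ _ 0≤s (‖‖²-nonneg (X 0)) s≤h s≤X ⟩
  h ℚ.* ‖ X 0 ‖²
    ≤⟨ *-mono-≤ _ _ _ _ 0≤h (+-nonneg _ _ (‖‖²-nonneg (X 0)) rest-nonneg)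
         (≤-from-diff (h ℚ.+ h) (+-nonneg h h 0≤h 0≤h) (ℚ.+-assoc h h h))
         (≤-from-diff _ rest-nonneg refl) ⟩
  (h ℚ.+ h ℚ.+ h) ℚ.* ∑[ a < suc K ] ‖ X (toℕ a) ‖² ∎
  where
  rest-nonneg : 0ℚ ℚ.≤ ∑[ a < K ] ‖ X (suc (toℕ a)) ‖²
  rest-nonneg = sum-nonneg {K} (λ a → ‖‖²-nonneg (X (suc (toℕ a))))
... | inj₂ h≤s = begin
  s ³
    -- With t = s - h ≥ 0, the difference 3hs² + t³ - s³ equals h²(3t + 2h).
    ≤⟨ ≤-from-diff (h ℚ.* (h ℚ.* (s ℚ.- h ℚ.+ (s ℚ.- h) ℚ.+ (s ℚ.- h) ℚ.+ (h ℚ.+ h))))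
         (*-nonneg _ _ 0≤h (*-nonneg _ _ 0≤h (+-nonneg _ _ (+-nonneg _ _ (+-nonneg _ _ 0≤t 0≤t) 0≤t) (+-nonneg _ _ 0≤h 0≤h))))
         (solve 2 (λ s h → let t = s :- h in
            (h :+ h :+ h) :* (s :* s) :+ t :* (t :* t) :=
            s :* (s :* s) :+ h :* (h :* (t :+ t :+ t :+ (h :+ h)))) refl s h) ⟩
  (h ℚ.+ h ℚ.+ h) ℚ.* (s ℚ.* s) ℚ.+ (s ℚ.- h) ³
    ≤⟨ ℚ.+-mono-≤ (*-mono-≤ _ _ _ _ 0≤3h (‖‖²-nonneg (X 0)) ℚ.≤-refl s≤X) ih ⟩
  (h ℚ.+ h ℚ.+ h) ℚ.* ‖ X 0 ‖² ℚ.+ (h ℚ.+ h ℚ.+ h) ℚ.* ∑[ a < K ] ‖ X (suc (toℕ a)) ‖²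
    ≡⟨ ℚ.*-distribˡ-+ (h ℚ.+ h ℚ.+ h) _ _ ⟨
  (h ℚ.+ h ℚ.+ h) ℚ.* ∑[ a < suc K ] ‖ X (toℕ a) ‖² ∎
  where
  0≤3h = +-nonneg _ _ (+-nonneg _ _ 0≤h 0≤h) 0≤h
  0≤t = 0≤-diff h≤s
  -- `X 1` is within `h` of `X 0`, so its modulus is still at least `s - h`, and the descent
  -- continues from there.
  ih = cube-descent (X ∘ suc) h 0≤h (steps ∘ suc) K (s ℚ.- h) 0≤t
    (reverse-triangle (X 0) (X 1) 0≤t 0≤h
      (subst (λ r → r ℚ.* r ℚ.≤ ‖ X 0 ‖²) (solve 2 (λ s h → s := s :- h :+ h) refl s h) s≤X) (steps 0))
    (unclose₁ s h (multiple K h) s≤Kh)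

-- Windows and correlations of a periodic sequence

sum² : ∀ {n} → (Fin n → ℚ²) → ℚ²
sum² F = sum (proj₁ ∘ F) , sum (proj₂ ∘ F)

‖sum²‖² : ∀ {n} (F : Fin n → ℚ²) → ‖ sum² F ‖² ≡ ∑[ j < n ] ∑[ k < n ] F j ∙ F k
‖sum²‖² {n} F = trans (cong₂ ℚ._+_ (square (proj₁ ∘ F)) (square (proj₂ ∘ F)))
  (sym (trans (sum-cong-≗ {n} (λ j → ∑-distrib-+ {n} _ _)) (∑-distrib-+ {n} _ _)))
  where
  square : (f : Fin n → ℚ) → sum f ℚ.* sum f ≡ ∑[ j < n ] ∑[ k < n ] (f j ℚ.* f k)
  square f = trans (*-distribʳ-sum (sum f) f) (sum-cong-≗ (λ j → *-distribˡ-sum (f j) f))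

module Correlation (m : ℕ) (F : ℕ → ℚ²) (F-periodic : ∀ i → F (i ℕ.+ m) ≡ F i) where

  -- The real part of the correlation at `d`: `z ∙ w` is the real part of z times the conjugate of
  -- w.
  corr : ℕ → ℚ
  corr d = ∑[ i < m ] F (toℕ i) ∙ F (toℕ i ℕ.+ d)

  shift-periodic : ∀ d i → F (i ℕ.+ m ℕ.+ d) ≡ F (i ℕ.+ d)
  shift-periodic d i = trans (cong F (swap i m d)) (F-periodic (i ℕ.+ d))
    where
    swap : ∀ i m d → i ℕ.+ m ℕ.+ d ≡ i ℕ.+ d ℕ.+ m
    swap = solve-∀

  -- Substituting i = a + j, a rotation over a full period, leaves a relative shift k - j.
  -- Periodicity allows it to be written `m ∸ j + k`, which stays within the natural numbers.
  shifted-corr : ∀ {j} k → j ℕ.≤ m →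
    ∑[ a < m ] F (toℕ a ℕ.+ j) ∙ F (toℕ a ℕ.+ k) ≡ corr (m ℕ.∸ j ℕ.+ k)
  shifted-corr {j} k j≤m = trans
    (sum-cong-≗ {m} (λ a → cong₂ _∙_ (cong F (ℕ.+-comm (toℕ a) j)) (sym (trans
      (cong F (trans (regroup (toℕ a) k j (m ℕ.∸ j)) (cong (toℕ a ℕ.+ k ℕ.+_) (ℕ.m+[n∸m]≡n j≤m))))
      (F-periodic (toℕ a ℕ.+ k))))))
    (sum-rotate m (λ i → F i ∙ F (i ℕ.+ (m ℕ.∸ j ℕ.+ k)))
      (λ i → cong₂ _∙_ (F-periodic i) (shift-periodic (m ℕ.∸ j ℕ.+ k) i)) j)
    where
    regroup : ∀ a k j r → j ℕ.+ a ℕ.+ (r ℕ.+ k) ≡ a ℕ.+ k ℕ.+ (j ℕ.+ r)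
    regroup = solve-∀

  window : ℕ → ℕ → ℚ²
  window L a = sum² {L} (λ j → F (a ℕ.+ toℕ j))

  windows-corr : ∀ {L} → L ℕ.≤ m →
    ∑[ a < m ] ‖ window L (toℕ a) ‖² ≡ ∑[ j < L ] ∑[ k < L ] corr (m ℕ.∸ toℕ j ℕ.+ toℕ k)
  windows-corr {L} L≤m = begin-equality
    ∑[ a < m ] ‖ window L (toℕ a) ‖²
      ≡⟨ sum-cong-≗ {m} (λ a → ‖sum²‖² {L} _) ⟩
    ∑[ a < m ] ∑[ j < L ] ∑[ k < L ] F (toℕ a ℕ.+ toℕ j) ∙ F (toℕ a ℕ.+ toℕ k)
      ≡⟨ ∑-comm {m} {L} _ ⟩
    ∑[ j < L ] ∑[ a < m ] ∑[ k < L ] F (toℕ a ℕ.+ toℕ j) ∙ F (toℕ a ℕ.+ toℕ k)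
      ≡⟨ sum-cong-≗ {L} (λ j → trans (∑-comm {m} {L} _) (sum-cong-≗ {L} (λ k →
           shifted-corr (toℕ k) (ℕ.≤-trans (ℕ.<⇒≤ (Fin.toℕ<n j)) L≤m)))) ⟩
    ∑[ j < L ] ∑[ k < L ] corr (m ℕ.∸ toℕ j ℕ.+ toℕ k) ∎

  -- For a fixed `j` the shifts form a run of L ≤ m consecutive numbers. Extending the sum of `χ`
  -- over this run to a full period bounds it independently of `j`, so each of the L rows costs at
  -- most one total of `χ` times `E`, plus L times `c`.
  windows-bound : ∀ {L} → L ℕ.≤ m → (χ : ℕ → ℚ) → (∀ i → χ (i ℕ.+ m) ≡ χ i) → (∀ d → 0ℚ ℚ.≤ χ d) →
    ∀ E c → 0ℚ ℚ.≤ E → (∀ d → corr d ℚ.≤ χ d ℚ.* E ℚ.+ c) →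
    let l = + L ℚ./ 1 in
    ∑[ a < m ] ‖ window L (toℕ a) ‖² ℚ.≤ l ℚ.* ((∑[ d < m ] χ (toℕ d)) ℚ.* E ℚ.+ l ℚ.* c)
  windows-bound {L} L≤m χ χ-periodic 0≤χ E c 0≤E corr≤ = begin
    ∑[ a < m ] ‖ window L (toℕ a) ‖²
      ≡⟨ windows-corr L≤m ⟩
    ∑[ j < L ] ∑[ k < L ] corr (m ℕ.∸ toℕ j ℕ.+ toℕ k)
      ≤⟨ sum-mono {L} (λ j → row (m ℕ.∸ toℕ j)) ⟩
    ∑[ j < L ] ((∑[ d < m ] χ (toℕ d)) ℚ.* E ℚ.+ l ℚ.* c)
      ≡⟨ sum-const L _ ⟩
    l ℚ.* ((∑[ d < m ] χ (toℕ d)) ℚ.* E ℚ.+ l ℚ.* c) ∎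
    where
    l = + L ℚ./ 1
    row : ∀ p → ∑[ k < L ] corr (p ℕ.+ toℕ k) ℚ.≤ (∑[ d < m ] χ (toℕ d)) ℚ.* E ℚ.+ l ℚ.* c
    row p = begin
      ∑[ k < L ] corr (p ℕ.+ toℕ k)
        ≤⟨ sum-mono {L} (λ k → corr≤ (p ℕ.+ toℕ k)) ⟩
      ∑[ k < L ] (χ (p ℕ.+ toℕ k) ℚ.* E ℚ.+ c)
        ≡⟨ ∑-distrib-+ {L} (λ k → χ (p ℕ.+ toℕ k) ℚ.* E) (λ _ → c) ⟩
      ∑[ k < L ] (χ (p ℕ.+ toℕ k) ℚ.* E) ℚ.+ ∑[ k < L ] c
        ≡⟨ cong₂ ℚ._+_ (sym (*-distribʳ-sum {L} E (λ k → χ (p ℕ.+ toℕ k)))) (sum-const L c) ⟩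
      (∑[ k < L ] χ (p ℕ.+ toℕ k)) ℚ.* E ℚ.+ l ℚ.* c
        ≤⟨ ℚ.+-monoˡ-≤ (l ℚ.* c) (ℚ.*-monoʳ-≤-nonNeg E {{ℚ.nonNegative 0≤E}}
             (ℚ.≤-trans (sum-prefix (χ ∘ (p ℕ.+_)) (0≤χ ∘ (p ℕ.+_)) L≤m)
                        (ℚ.≤-reflexive (sum-rotate m χ χ-periodic p)))) ⟩
      (∑[ d < m ] χ (toℕ d)) ℚ.* E ℚ.+ l ℚ.* c ∎

  energy-nonneg : 0ℚ ℚ.≤ ∑[ i < m ] ‖ F (toℕ i) ‖²
  energy-nonneg = sum-nonneg {m} (λ i → ‖‖²-nonneg (F (toℕ i)))

  -- Termwise, 2 z∙w ≤ ‖z‖² + ‖w‖²; by periodicity the shifted squares have the same total as the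
  -- unshifted ones.
  corr≤energy : ∀ d → corr d ℚ.≤ ∑[ i < m ] ‖ F (toℕ i) ‖²
  corr≤energy d = halve (begin
    corr d ℚ.+ corr d
      ≡⟨ ∑-distrib-+ {m} _ _ ⟨
    ∑[ i < m ] (F (toℕ i) ∙ F (toℕ i ℕ.+ d) ℚ.+ F (toℕ i) ∙ F (toℕ i ℕ.+ d))
      ≤⟨ sum-mono {m} (λ i → am-gm (F (toℕ i)) (F (toℕ i ℕ.+ d))) ⟩
    ∑[ i < m ] (‖ F (toℕ i) ‖² ℚ.+ ‖ F (toℕ i ℕ.+ d) ‖²)
      ≡⟨ ∑-distrib-+ {m} _ _ ⟩
    E ℚ.+ ∑[ i < m ] ‖ F (toℕ i ℕ.+ d) ‖²
      ≡⟨ cong (E ℚ.+_) (trans (sum-cong-≗ {m} (λ i → cong (‖_‖² ∘ F) (ℕ.+-comm (toℕ i) d)))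
           (sum-rotate m (‖_‖² ∘ F) (cong ‖_‖² ∘ F-periodic) d)) ⟩
    E ℚ.+ E ∎)
    where
    E = ∑[ i < m ] ‖ F (toℕ i) ‖²
    halve : ∀ {p q} → p ℚ.+ p ℚ.≤ q ℚ.+ q → p ℚ.≤ q
    halve h = ℚ.≮⇒≥ λ q<p → ℚ.<-irrefl refl (ℚ.<-≤-trans (ℚ.+-mono-< q<p q<p) h)
    am-gm : ∀ z w → z ∙ w ℚ.+ z ∙ w ℚ.≤ ‖ z ‖² ℚ.+ ‖ w ‖²
    am-gm z@(a , b) w@(c , d) = ≤-from-diff ‖ z ⊟ w ‖² (‖‖²-nonneg (z ⊟ w))
      (solve 4 (λ a b c d → (a :* a :+ b :* b) :+ (c :* c :+ d :* d) :=
        (a :* c :+ b :* d) :+ (a :* c :+ b :* d) :+ ((a :- c) :* (a :- c) :+ (b :- d) :* (b :- d))) refl a b c d)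

  module _ (M : ℚ) (0≤M : 0ℚ ℚ.≤ M) (F≤M : ∀ i → ‖ F i ‖² ℚ.≤ M ℚ.* M) where

    private
      h = M ℚ.+ M
      0≤h = +-nonneg M M 0≤M 0≤M

    -- Serves to show that L steps of size at most 2M are enough for the descent starting from
    -- `window L 0`.
    window-bound : ∀ L a → ‖ window L a ‖² ℚ.≤ multiple L M ℚ.* multiple L M
    window-bound zero    a = ℚ.≤-refl
    window-bound (suc L) a = triangle (F (a ℕ.+ 0)) (sum² {L} (λ j → F (a ℕ.+ suc (toℕ j))))
      0≤M (sum-nonneg {L} (λ _ → 0≤M)) (F≤M (a ℕ.+ 0))
      (subst (λ z → ‖ z ‖² ℚ.≤ multiple L M ℚ.* multiple L M)
        (cong₂ _,_ (sum-cong-≗ {L} (λ j → cong (proj₁ ∘ F) (sym (ℕ.+-suc a (toℕ j)))))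
                   (sum-cong-≗ {L} (λ j → cong (proj₂ ∘ F) (sym (ℕ.+-suc a (toℕ j))))))
        (window-bound L (suc a)))

    -- Adjacent windows overlap in all but one point each, so their difference is `F a` minus
    -- `F (a + L)`, two terms of modulus at most `M`.
    window-step : ∀ L a → ‖ window L a ⊟ window L (suc a) ‖² ℚ.≤ h ℚ.* h
    window-step L a = subst (λ z → ‖ z ‖² ℚ.≤ h ℚ.* h)
      (sym (cong₂ _,_ (telescope (proj₁ ∘ F)) (telescope (proj₂ ∘ F))))
      (triangle (F a) (⊝ (F (a ℕ.+ L))) 0≤M 0≤M (F≤M a)
        (subst (ℚ._≤ M ℚ.* M) (sym (‖⊝‖² (F (a ℕ.+ L)))) (F≤M (a ℕ.+ L))))
      where
      ⊝ : ℚ² → ℚ²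
      ⊝ (a , b) = ℚ.- a , ℚ.- b
      ‖⊝‖² : ∀ z → ‖ ⊝ z ‖² ≡ ‖ z ‖²
      ‖⊝‖² (a , b) = solve 2 (λ a b → :- a :* :- a :+ :- b :* :- b := a :* a :+ b :* b) refl a b
      telescope : ∀ (f : ℕ → ℚ) → ∑[ j < L ] f (a ℕ.+ toℕ j) ℚ.- ∑[ j < L ] f (suc a ℕ.+ toℕ j) ≡
                  f a ℚ.- f (a ℕ.+ L)
      telescope f = cancel (f a) _ (∑[ j < L ] f (a ℕ.+ toℕ j)) (f (a ℕ.+ L)) (trans (cong₂ ℚ._+_ (cong f (sym (ℕ.+-identityʳ a)))
          (sum-cong-≗ {L} (λ j → cong f (sym (ℕ.+-suc a (toℕ j))))))
        (sum-snoc L (f ∘ (a ℕ.+_))))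
        where
        cancel : ∀ p q r s → p ℚ.+ q ≡ r ℚ.+ s → r ℚ.- q ≡ p ℚ.- s
        cancel p q r s eq = begin-equality
          r ℚ.- q                    ≡⟨ solve 3 (λ q r s → r :- q := r :+ s :- (q :+ s)) refl q r s ⟩
          r ℚ.+ s ℚ.- (q ℚ.+ s)      ≡⟨ cong (ℚ._- (q ℚ.+ s)) eq ⟨
          p ℚ.+ q ℚ.- (q ℚ.+ s)      ≡⟨ solve 3 (λ p q s → p :+ q :- (q :+ s) := p :- s) refl p q s ⟩
          p ℚ.- s                    ∎

    -- The descent uses only the first L windows; the sum is enlarged to a full period because the
    -- expansion into correlations requires one.
    cube-bound : ∀ {L} → L ℕ.≤ m → ∀ s → 0ℚ ℚ.≤ s → s ℚ.* s ℚ.≤ ‖ window L 0 ‖² →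
      s ³ ℚ.≤ (h ℚ.+ h ℚ.+ h) ℚ.* ∑[ a < m ] ‖ window L (toℕ a) ‖²
    cube-bound {L} L≤m s 0≤s s≤X = begin
      s ³
        ≤⟨ cube-descent (window L) h 0≤h (window-step L) L s 0≤s s≤X s≤Lh ⟩
      (h ℚ.+ h ℚ.+ h) ℚ.* ∑[ a < L ] ‖ window L (toℕ a) ‖²
        ≤⟨ ℚ.*-monoˡ-≤-nonNeg (h ℚ.+ h ℚ.+ h) {{ℚ.nonNegative (+-nonneg _ _ (+-nonneg _ _ 0≤h 0≤h) 0≤h)}}
             (sum-prefix (‖_‖² ∘ window L) (‖‖²-nonneg ∘ window L) L≤m) ⟩
      (h ℚ.+ h ℚ.+ h) ℚ.* ∑[ a < m ] ‖ window L (toℕ a) ‖² ∎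
      where
      -- The trivial bound on the window gives even `s ≤ multiple L M`, and `M ≤ h`.
      s≤Lh : s ℚ.≤ multiple L h
      s≤Lh = ℚ.≤-trans
        (sq-cancel-≤ (sum-nonneg {L} (λ _ → 0≤M)) (ℚ.≤-trans s≤X (window-bound L 0)))
        (sum-mono {L} (λ _ → ≤-from-diff M 0≤M refl))

-- The cubic inequality for rational-valued functions on ℤ/mℤ

module Interval {m : ℕ} .{{_ : NonZero m}} (φ : ℤ/ m → ℚ²) {I D : Subset m} (interval : IsInterval I) where

  private
    lo = proj₁ (interval-elements {m} interval)
    i = + ∣ I ∣ ℚ./ 1
    d = + ∣ D ∣ ℚ./ 1
    E = ∑[ x < m ] ‖ φ x ‖²

    -- Numbered from the left end `lo` of the interval, so that `window ∣ I ∣ 0` is the sum over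
    -- `I`.
    F : ℕ → ℚ²
    F k = φ (residue (lo ℕ.+ k))

    +-periodic : ∀ p k → residue {m} (p ℕ.+ (k ℕ.+ m)) ≡ residue (p ℕ.+ k)
    +-periodic p k = trans (cong residue (sym (ℕ.+-assoc p k m))) (residue-periodic (p ℕ.+ k))

    open Correlation m F (cong φ ∘ +-periodic lo)

    sum-residue : ∀ (f : ℤ/ m → ℚ) → ∑[ k < m ] f (residue (lo ℕ.+ toℕ k)) ≡ ∑[ x < m ] f x
    sum-residue f = trans (sum-rotate m (f ∘ residue) (cong f ∘ residue-periodic) lo)
                          (sum-cong-≗ {m} (cong f ∘ residue-toℕ))

    -- The starting point `lo` disappears because the sum runs over a full period.
    corr-residue : ∀ k → corr k ≡ ∑[ x < m ] φ x ∙ φ (x ⊕ residue k)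
    corr-residue k = trans
      (sum-cong-≗ {m} (λ x → cong (λ n → φ (residue (lo ℕ.+ toℕ x)) ∙ φ (residue n)) (sym (ℕ.+-assoc lo (toℕ x) k))))
      (trans (sum-rotate m (λ n → φ (residue n) ∙ φ (residue (n ℕ.+ k)))
                (λ n → cong₂ (λ x y → φ x ∙ φ y) (residue-periodic n)
                   (trans (cong residue (trans (cong (ℕ._+ k) (ℕ.+-comm n m)) (trans (ℕ.+-assoc m n k) (ℕ.+-comm m (n ℕ.+ k)))))
                          (residue-periodic (n ℕ.+ k)))) lo)
             (sum-cong-≗ {m} (λ x → cong₂ (λ y z → φ y ∙ φ z) (residue-toℕ x) (sym (⊕-residue x k)))))

    sum-interval : ∀ (f : ℤ/ m → ℚ) → sumOver f (elements I) ≡ ∑[ k < ∣ I ∣ ] f (residue (lo ℕ.+ toℕ k))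
    sum-interval f = trans (sumOver-↭ f (proj₂ (interval-elements {m} interval)))
                           (sumOver-applyUpTo f (residue ∘ (lo ℕ.+_)) ∣ I ∣)

    energy : ∑[ k < m ] ‖ F (toℕ k) ‖² ≡ E
    energy = sum-residue (‖_‖² ∘ φ)

  interval-cube-bound : ∀ {M c s} → 0ℚ ℚ.≤ M → (∀ x → ‖ φ x ‖² ℚ.≤ M ℚ.* M) →
    0ℚ ℚ.≤ c → (∀ a → a ∉ₛ D → ∑[ x < m ] φ x ∙ φ (x ⊕ a) ℚ.≤ c) →
    0ℚ ℚ.≤ s → s ℚ.* s ℚ.≤ ‖ sumOver (proj₁ ∘ φ) (elements I) , sumOver (proj₂ ∘ φ) (elements I) ‖² →
    s ³ ℚ.≤ ((M ℚ.+ M) ℚ.+ (M ℚ.+ M) ℚ.+ (M ℚ.+ M)) ℚ.* (i ℚ.* (d ℚ.* E ℚ.+ i ℚ.* c))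
  interval-cube-bound {M} {c} {s} 0≤M φ≤M 0≤c corr≤c 0≤s s≤S = begin
    s ³
      ≤⟨ cube-bound M 0≤M (φ≤M ∘ residue ∘ (lo ℕ.+_)) (∣p∣≤n I) s 0≤s
           (subst (λ z → s ℚ.* s ℚ.≤ ‖ z ‖²) (cong₂ _,_ (sum-interval (proj₁ ∘ φ)) (sum-interval (proj₂ ∘ φ))) s≤S) ⟩
    6M ℚ.* ∑[ a < m ] ‖ window ∣ I ∣ (toℕ a) ‖²
      ≤⟨ ℚ.*-monoˡ-≤-nonNeg 6M {{ℚ.nonNegative (+-nonneg _ _ (+-nonneg _ _ 0≤2M 0≤2M) 0≤2M)}}
           (windows-bound (∣p∣≤n I) χ (cong (indicator D) ∘ residue-periodic)
              (indicator-nonneg D ∘ residue) _ c energy-nonneg corr≤) ⟩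
    6M ℚ.* (i ℚ.* ((∑[ k < m ] χ (toℕ k)) ℚ.* ∑[ k < m ] ‖ F (toℕ k) ‖² ℚ.+ i ℚ.* c))
      ≡⟨ cong₂ (λ x y → 6M ℚ.* (i ℚ.* (x ℚ.* y ℚ.+ i ℚ.* c)))
           (trans (sum-cong-≗ {m} (cong (indicator D) ∘ residue-toℕ)) (sum-indicator D)) energy ⟩
    6M ℚ.* (i ℚ.* (d ℚ.* E ℚ.+ i ℚ.* c)) ∎
    where
    6M = (M ℚ.+ M) ℚ.+ (M ℚ.+ M) ℚ.+ (M ℚ.+ M)
    0≤2M = +-nonneg M M 0≤M 0≤M
    χ : ℕ → ℚ
    χ k = indicator D (residue k)
    corr≤ : ∀ k → corr k ℚ.≤ χ k ℚ.* (∑[ j < m ] ‖ F (toℕ j) ‖²) ℚ.+ c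
    corr≤ k with residue {m} k ∈? D
    -- For shifts in `D` only the trivial bound by the energy is available; outside `D` the
    -- indicator vanishes and the hypothesis on correlations applies.
    ... | yes _ = begin
      corr k              ≤⟨ corr≤energy k ⟩
      e                   ≡⟨ ℚ.+-identityʳ e ⟨
      e ℚ.+ 0ℚ            ≤⟨ ℚ.+-mono-≤ (ℚ.≤-reflexive (sym (ℚ.*-identityˡ e))) 0≤c ⟩
      1ℚ ℚ.* e ℚ.+ c      ∎
      where e = ∑[ j < m ] ‖ F (toℕ j) ‖²
    ... | no k∉D = begin
      corr k              ≡⟨ corr-residue k ⟩
      _                   ≤⟨ corr≤c (residue k) k∉D ⟩
      c                   ≡⟨ ℚ.+-identityˡ c ⟨
      0ℚ ℚ.+ c            ≡⟨ cong (ℚ._+ c) (ℚ.*-zeroˡ e) ⟨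
      0ℚ ℚ.* e ℚ.+ c      ∎
      where e = ∑[ j < m ] ‖ F (toℕ j) ‖²

-- Real and complex numbers

pointwise-≤ : ∀ {x y} → (∀ n → seq x n ℚ.≤ seq y n) → x ≤ y
pointwise-≤ {x} {y} x≤y ε 0<ε = 0 , λ n _ → ℚ.≤-trans (x≤y n) (≤-from-diff ε (ℚ.<⇒≤ 0<ε) refl)

≤-trans : ∀ {x y z} → x ≤ y → y ≤ z → x ≤ z
≤-trans {x} {y} {z} x≤y y≤z ε 0<ε =
  let M , f = x≤y (½ ℚ.* ε) (half-pos 0<ε)
      N , g = y≤z (½ ℚ.* ε) (half-pos 0<ε)
  in M ℕ.⊔ N , λ n p → begin
    seq x n
      ≤⟨ f n (ℕ.m⊔n≤o⇒m≤o M N p) ⟩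
    seq y n ℚ.+ ½ ℚ.* ε
      ≤⟨ ℚ.+-monoˡ-≤ (½ ℚ.* ε) (g n (ℕ.m⊔n≤o⇒n≤o M N p)) ⟩
    seq z n ℚ.+ ½ ℚ.* ε ℚ.+ ½ ℚ.* ε
      ≡⟨ trans (ℚ.+-assoc (seq z n) _ _) (cong (seq z n ℚ.+_) (half+half ε)) ⟩
    seq z n ℚ.+ ε ∎

pointwise-≈ : ∀ {x y} → (∀ n → seq x n ≡ seq y n) → x ≈ y
pointwise-≈ {x} {y} eq = pointwise-≤ {x} {y} (ℚ.≤-reflexive ∘ eq) , pointwise-≤ {y} {x} (ℚ.≤-reflexive ∘ sym ∘ eq)

≈-refl : ∀ {x} → x ≈ x
≈-refl {x} = pointwise-≈ {x} {x} (λ _ → refl)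

≈-sym : ∀ {x y} → x ≈ y → y ≈ x
≈-sym (x≤y , y≤x) = y≤x , x≤y

≈-trans : ∀ {x y z} → x ≈ y → y ≈ z → x ≈ z
≈-trans {x} {y} {z} (x≤y , y≤x) (y≤z , z≤y) = ≤-trans {x} {y} {z} x≤y y≤z , ≤-trans {z} {y} {x} z≤y y≤x

+-mono-≤ : ∀ {x y z w} → x ≤ y → z ≤ w → x + z ≤ y + w
+-mono-≤ {x} {y} {z} {w} x≤y z≤w ε 0<ε =
  let M , f = x≤y (½ ℚ.* ε) (half-pos 0<ε)
      N , g = z≤w (½ ℚ.* ε) (half-pos 0<ε)
  in M ℕ.⊔ N , λ n p → begin
    seq x n ℚ.+ seq z n
      ≤⟨ ℚ.+-mono-≤ (f n (ℕ.m⊔n≤o⇒m≤o M N p)) (g n (ℕ.m⊔n≤o⇒n≤o M N p)) ⟩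
    seq y n ℚ.+ ½ ℚ.* ε ℚ.+ (seq w n ℚ.+ ½ ℚ.* ε)
      ≡⟨ solve 3 (λ y w e → y :+ e :+ (w :+ e) := y :+ w :+ (e :+ e)) refl (seq y n) (seq w n) (½ ℚ.* ε) ⟩
    seq y n ℚ.+ seq w n ℚ.+ (½ ℚ.* ε ℚ.+ ½ ℚ.* ε)
      ≡⟨ cong (seq y n ℚ.+ seq w n ℚ.+_) (half+half ε) ⟩
    seq y n ℚ.+ seq w n ℚ.+ ε ∎

+-cong : ∀ {x y z w} → x ≈ y → z ≈ w → x + z ≈ y + w
+-cong {x} {y} {z} {w} (x≤y , y≤x) (z≤w , w≤z) =
  +-mono-≤ {x} {y} {z} {w} x≤y z≤w , +-mono-≤ {y} {x} {w} {z} y≤x w≤z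

-- The factor `x` is eventually bounded by some B, and `y` and `z` eventually differ by at most δ
-- with B δ = ε.
*-congˡ : ∀ x {y z} → y ≈ z → x * y ≈ x * z
*-congˡ x {y} {z} y≈z = half y z y≈z , half z y (≈-sym {y} {z} y≈z)
  where
  half : ∀ y z → y ≈ z → x * y ≤ x * z
  half y z (y≤z , z≤y) ε 0<ε =
    let B , 0<B , K , bound = eventually-bounded (seq x) (cauchy x)
        δ , 0<δ , Bδ≡ε      = ∃-divide 0<ε 0<B
        M , f               = y≤z δ 0<δ
        N , g               = z≤y δ 0<δ
    in K ℕ.⊔ (M ℕ.⊔ N) , λ n p →
      let q = ℕ.m⊔n≤o⇒n≤o K (M ℕ.⊔ N) p in
      close (seq x n ℚ.* seq y n) (seq x n ℚ.* seq z n) (begin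
      ℚ.∣ seq x n ℚ.* seq y n ℚ.- seq x n ℚ.* seq z n ∣
        ≡⟨ cong ℚ.∣_∣ (solve 3 (λ x y z → x :* y :- x :* z := x :* (y :- z)) refl (seq x n) (seq y n) (seq z n)) ⟩
      ℚ.∣ seq x n ℚ.* (seq y n ℚ.- seq z n) ∣
        ≡⟨ ℚ.∣p*q∣≡∣p∣*∣q∣ (seq x n) (seq y n ℚ.- seq z n) ⟩
      ℚ.∣ seq x n ∣ ℚ.* ℚ.∣ seq y n ℚ.- seq z n ∣
        ≤⟨ *-mono-≤ _ _ _ _ (ℚ.0≤∣p∣ (seq x n)) (ℚ.<⇒≤ 0<δ) (bound n (ℕ.m⊔n≤o⇒m≤o K (M ℕ.⊔ N) p))
             (unclose (seq y n) (seq z n) δ (f n (ℕ.m⊔n≤o⇒m≤o M N q)) (g n (ℕ.m⊔n≤o⇒n≤o M N q))) ⟩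
      B ℚ.* δ
        ≡⟨ Bδ≡ε ⟩
      ε ∎)

*-comm : ∀ x y → x * y ≈ y * x
*-comm x y = pointwise-≈ {x * y} {y * x} (λ n → ℚ.*-comm (seq x n) (seq y n))

*-cong : ∀ {x y z w} → x ≈ y → z ≈ w → x * z ≈ y * w
*-cong {x} {y} {z} {w} x≈y z≈w =
  ≈-trans {x * z} {x * w} {y * w} (*-congˡ x {z} {w} z≈w)
    (≈-trans {x * w} {w * x} {y * w} (*-comm x w)
      (≈-trans {w * x} {w * y} {y * w} (*-congˡ w {x} {y} x≈y) (*-comm w y)))

^-cong : ∀ {x y} k → x ≈ y → x ^ k ≈ y ^ k
^-cong zero    x≈y = ≈-refl {1ℝ}
^-cong {x} {y} (suc k) x≈y = *-cong {x} {y} {x ^ k} {y ^ k} x≈y (^-cong {x} {y} k x≈y)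

seq-^ : ∀ x k n → seq (x ^ k) n ≡ seq x n ^ℚ k
seq-^ x zero    n = refl
seq-^ x (suc k) n = cong (seq x n ℚ.*_) (seq-^ x k n)

-- The resolution 1/(n+1) of the n-th rational root, as a real number.
γ : ℝ
γ = mkℝ (λ n → grid n 1) λ ε 0<ε →
  let N , f = archimedean 0<ε in N , λ i j N≤i N≤j → unclose (grid i 1) (grid j 1) ε
    (ℚ.≤-trans (f i N≤i) (≤-from-diff (grid j 1) (grid-nonneg j 1) (ℚ.+-comm (grid j 1) ε)))
    (ℚ.≤-trans (f j N≤j) (≤-from-diff (grid i 1) (grid-nonneg i 1) (ℚ.+-comm (grid i 1) ε)))

γ≈0 : γ ≈ 0ℝ
γ≈0 = (λ ε 0<ε → map₂ (λ f n N≤n → ℚ.≤-trans (f n N≤n) (ℚ.≤-reflexive (sym (ℚ.+-identityˡ ε)))) (archimedean 0<ε))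
    , pointwise-≤ {0ℝ} {γ} (λ n → grid-nonneg n 1)

+γ : ∀ x → x + γ ≈ x
+γ x = ≈-trans {x + γ} {x + 0ℝ} {x} (+-cong {x} {x} {γ} {0ℝ} (≈-refl {x}) γ≈0)
         (pointwise-≈ {x + 0ℝ} {x} (λ n → ℚ.+-identityʳ (seq x n)))

-- Imposed on every term, which is stronger than `0ℝ ≤ x`: rational inequalities can then be applied
-- term by term.
Nonneg : ℝ → Set
Nonneg x = ∀ n → 0ℚ ℚ.≤ seq x n

root-nonneg : ∀ k .{{_ : NonZero k}} x → Nonneg (root k x)
root-nonneg k x n = rootℚ-nonneg k n (seq x n)

-- `rootℚ` rounds down to a multiple of 1/(n+1), so its power does not exceed the term; adding one
-- grid step, as in `≤-root+γ-^`, compensates for the rounding.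
root-^-≤ : ∀ k .{{_ : NonZero k}} x → Nonneg x → ∀ n → seq (root k x) n ^ℚ k ℚ.≤ seq x n
root-^-≤ k x 0≤x n = ℚ.≤-trans (proj₁ (rootℚ-spec k n (seq x n))) (ℚ.≤-reflexive (ℚ.p≥q⇒p⊔q≡p (0≤x n)))

≤-root+γ-^ : ∀ k .{{_ : NonZero k}} x n → seq x n ℚ.≤ (seq (root k x) n ℚ.+ grid n 1) ^ℚ k
≤-root+γ-^ k x n = ℚ.≤-trans (ℚ.p≤p⊔q (seq x n) 0ℚ) (ℚ.<⇒≤ (proj₂ (rootℚ-spec k n (seq x n))))

-- The term of `x` lies between the k-th powers of the rounded root and of the root plus `γ`, and
-- these agree in the limit.
root-^ : ∀ k .{{_ : NonZero k}} x → Nonneg x → root k x ^ k ≈ x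
root-^ k x 0≤x =
    pointwise-≤ {root k x ^ k} {x} (λ n → subst (ℚ._≤ seq x n) (sym (seq-^ (root k x) k n)) (root-^-≤ k x 0≤x n))
  , ≤-trans {x} {(root k x + γ) ^ k} {root k x ^ k}
      (pointwise-≤ {x} {(root k x + γ) ^ k} λ n →
        subst (seq x n ℚ.≤_) (sym (seq-^ (root k x + γ) k n)) (≤-root+γ-^ k x n))
      (proj₁ (^-cong {root k x + γ} {root k x} k (+γ (root k x))))

-- If y + ε < x at some late term, superadditivity of the power separates the two powers by at least
-- e, the same power of ε; the hypothesis is used with e/2, which yields a strict contradiction.
^-cancel-≤ : ∀ k {x y} → Nonneg y → x ^ suc k ≤ y ^ suc k → x ≤ y
^-cancel-≤ k {x} {y} 0≤y xᵏ≤yᵏ ε 0<ε =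
  let e     = ε ^ℚ suc k
      0<e   = ^-pos ε (suc k) 0<ε
      N , f = xᵏ≤yᵏ (½ ℚ.* e) (half-pos 0<e)
  in N , λ n N≤n → ℚ.≮⇒≥ λ y+ε<x → ℚ.<-irrefl refl (begin-strict
    seq y n ^ℚ suc k ℚ.+ ½ ℚ.* e
      <⟨ ℚ.+-monoʳ-< (seq y n ^ℚ suc k) (½e<e 0<e) ⟩
    seq y n ^ℚ suc k ℚ.+ e
      ≤⟨ ^-superadditive (seq y n) ε k (0≤y n) (ℚ.<⇒≤ 0<ε) ⟩
    (seq y n ℚ.+ ε) ^ℚ suc k
      ≤⟨ ^-mono-≤ _ _ (suc k) (+-nonneg _ _ (0≤y n) (ℚ.<⇒≤ 0<ε)) (ℚ.<⇒≤ y+ε<x) ⟩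
    seq x n ^ℚ suc k
      ≡⟨ seq-^ x (suc k) n ⟨
    seq (x ^ suc k) n
      ≤⟨ f n N≤n ⟩
    seq (y ^ suc k) n ℚ.+ ½ ℚ.* e
      ≡⟨ cong (ℚ._+ ½ ℚ.* e) (seq-^ y (suc k) n) ⟩
    seq y n ^ℚ suc k ℚ.+ ½ ℚ.* e ∎)
  where
  ½e<e : ∀ {e} → 0ℚ ℚ.< e → ½ ℚ.* e ℚ.< e
  ½e<e {e} 0<e = begin-strict
    ½ ℚ.* e               ≡⟨ ℚ.+-identityʳ _ ⟨
    ½ ℚ.* e ℚ.+ 0ℚ        <⟨ ℚ.+-monoʳ-< (½ ℚ.* e) (half-pos 0<e) ⟩
    ½ ℚ.* e ℚ.+ ½ ℚ.* e   ≡⟨ half+half e ⟩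
    e                     ∎

sumℝ : ∀ {A : Set} → (A → ℝ) → List A → ℝ
sumℝ f xs = foldr _+_ 0ℝ (map f xs)

seq-sumℝ : ∀ {A : Set} (f : A → ℝ) xs n → seq (sumℝ f xs) n ≡ sumOver (λ x → seq (f x) n) xs
seq-sumℝ f []       n = refl
seq-sumℝ f (x ∷ xs) n = cong (seq (f x) n ℚ.+_) (seq-sumℝ f xs n)

sumℝ-cong : ∀ {A : Set} {f g : A → ℝ} → (∀ x → f x ≈ g x) → ∀ xs → sumℝ f xs ≈ sumℝ g xs
sumℝ-cong f≈g []       = ≈-refl {0ℝ}
sumℝ-cong {f = f} {g} f≈g (x ∷ xs) =
  +-cong {f x} {g x} {sumℝ f xs} {sumℝ g xs} (f≈g x) (sumℝ-cong {f = f} {g} f≈g xs)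

≤-maxOver : ∀ {m} (B : Subset m) (f : ℤ/ m → ℝ) {x} → x ∈ₛ B → ∀ n → seq (f x) n ℚ.≤ seq (maxOver B f) n
≤-maxOver B f x∈B n = go (Equivalence.from ∈-elements x∈B)
  where
  go : ∀ {x xs} → x ∈ xs → seq (f x) n ℚ.≤ seq (foldr _⊔_ 0ℝ (map f xs)) n
  go {x} (here refl)            = ℚ.p≤p⊔q (seq (f x) n) _
  go {xs = y ∷ _} (there x∈xs) = ℚ.≤-trans (go x∈xs) (ℚ.p≤q⊔p (seq (f y) n) _)

maxOver-nonneg : ∀ {m} (B : Subset m) (f : ℤ/ m → ℝ) → Nonneg (maxOver B f)
maxOver-nonneg B f n = go (elements B)
  where
  go : ∀ xs → 0ℚ ℚ.≤ seq (foldr _⊔_ 0ℝ (map f xs)) n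
  go []       = ℚ.≤-refl
  go (x ∷ xs) = ℚ.≤-trans (go xs) (ℚ.p≤q⊔p (seq (f x) n) _)

approx : ℕ → ℂ → ℚ²
approx n z = seq (re z) n , seq (im z) n

normSq : ℂ → ℝ
normSq z = re z ^ 2 + im z ^ 2

seq-normSq : ∀ z n → seq (normSq z) n ≡ ‖ approx n z ‖²
seq-normSq z n = solve 2 (λ a b → a :* (a :* con 1ℚ) :+ b :* (b :* con 1ℚ) := a :* a :+ b :* b) refl
  (seq (re z) n) (seq (im z) n)

normSq-nonneg : ∀ z → Nonneg (normSq z)
normSq-nonneg z n = subst (0ℚ ℚ.≤_) (sym (seq-normSq z n)) (‖‖²-nonneg (approx n z))

^ℚ2 : ∀ p → p ^ℚ 2 ≡ p ℚ.* p
^ℚ2 p = cong (p ℚ.*_) (ℚ.*-identityʳ p)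

modulus-lower : ∀ z n → seq ∣ z ∣ᶜ n ℚ.* seq ∣ z ∣ᶜ n ℚ.≤ ‖ approx n z ‖²
modulus-lower z n = subst₂ ℚ._≤_ (^ℚ2 (seq ∣ z ∣ᶜ n)) (seq-normSq z n) (root-^-≤ 2 (normSq z) (normSq-nonneg z) n)

modulus-upper : ∀ z n → let r = seq ∣ z ∣ᶜ n ℚ.+ grid n 1 in ‖ approx n z ‖² ℚ.≤ r ℚ.* r
modulus-upper z n = subst₂ ℚ._≤_ (seq-normSq z n) (^ℚ2 (seq ∣ z ∣ᶜ n ℚ.+ grid n 1)) (≤-root+γ-^ 2 (normSq z) n)

re≤modulus : ∀ z n → seq (re z) n ℚ.≤ seq ∣ z ∣ᶜ n ℚ.+ grid n 1
re≤modulus z n = sq-cancel-≤ (+-nonneg _ _ (root-nonneg 2 (normSq z) n) (grid-nonneg n 1))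
  (ℚ.≤-trans (≤-from-diff _ (sq-nonneg (seq (im z) n)) refl) (modulus-upper z n))

approx-sum : ∀ {A : Set} (f : A → ℂ) xs n → approx n (foldr _+ᶜ_ 0ℂ (map f xs)) ≡
  (sumOver (proj₁ ∘ approx n ∘ f) xs , sumOver (proj₂ ∘ approx n ∘ f) xs)
approx-sum f []       n = refl
approx-sum f (x ∷ xs) n = cong (approx n (f x) ⊞_) (approx-sum f xs n)

-- The inequality of cubes over the reals

cubic-bound : ℝ → ℝ → ℝ → ℝ → ℝ → ℝ
cubic-bound M i d E c = ((M + M) + (M + M) + (M + M)) * (i * (d * E + i * c))

cubic-bound-cong : ∀ {M M′ i i′ d d′ E E′ c c′} → M ≈ M′ → i ≈ i′ → d ≈ d′ → E ≈ E′ → c ≈ c′ →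
                   cubic-bound M i d E c ≈ cubic-bound M′ i′ d′ E′ c′
cubic-bound-cong {M} {M′} {i} {i′} {d} {d′} {E} {E′} {c} {c′} M≈ i≈ d≈ E≈ c≈ =
  *-cong {2M + 2M + 2M} {2M′ + 2M′ + 2M′} {i * (d * E + i * c)} {i′ * (d′ * E′ + i′ * c′)}
    (+-cong {2M + 2M} {2M′ + 2M′} {2M} {2M′} (+-cong {2M} {2M′} {2M} {2M′} 2M≈ 2M≈) 2M≈)
    (*-cong {i} {i′} {d * E + i * c} {d′ * E′ + i′ * c′} i≈
      (+-cong {d * E} {d′ * E′} {i * c} {i′ * c′} (*-cong {d} {d′} {E} {E′} d≈ E≈) (*-cong {i} {i′} {c} {c′} i≈ c≈)))
  where
  2M = M + M
  2M′ = M′ + M′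
  2M≈ = +-cong {M} {M′} {M} {M′} M≈ M≈

-- 6μ³ι³(δ³ν⁶ + ι³k³) ≤ (2μδιν²)³ + (2μι²k)³, and cubing is superadditive.
cube-of-bound : ∀ μ ι δ ν k w → 0ℚ ℚ.≤ μ → 0ℚ ℚ.≤ ι → 0ℚ ℚ.≤ δ → 0ℚ ℚ.≤ ν → 0ℚ ℚ.≤ k → 0ℚ ℚ.≤ w →
  let M = μ ^ℚ 3 in
  ((M ℚ.+ M) ℚ.+ (M ℚ.+ M) ℚ.+ (M ℚ.+ M)) ℚ.* (ι ^ℚ 3 ℚ.* (δ ^ℚ 3 ℚ.* (ν ^ℚ 3) ^ℚ 2 ℚ.+ ι ^ℚ 3 ℚ.* k ^ℚ 3))
  ℚ.≤ ((+ 2 / 1) ℚ.* (μ ℚ.* 1ℚ) ℚ.*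
        ( (δ ℚ.* 1ℚ) ℚ.* (ι ℚ.* 1ℚ) ℚ.* ν ^ℚ 2 ℚ.+ ι ^ℚ 2 ℚ.* k ℚ.+ w )) ^ℚ 3
cube-of-bound μ ι δ ν k w 0≤μ 0≤ι 0≤δ 0≤ν 0≤k 0≤w = begin
  ((M ℚ.+ M) ℚ.+ (M ℚ.+ M) ℚ.+ (M ℚ.+ M)) ℚ.* T
    -- The factors 2 in `a` and `b` make their cubes add up to exactly 8MT, which leaves 2MT to
    -- spare over the coefficient 6.
    ≤⟨ ≤-from-diff ((M ℚ.+ M) ℚ.* T) (*-nonneg _ _ (+-nonneg M M 0≤M 0≤M) 0≤T)
         (solve 5 (λ μ ι δ ν k → let cube = λ x → x :* (x :* (x :* con 1ℚ)) ; sq = λ x → x :* (x :* con 1ℚ)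
                                     M = cube μ ; T = cube ι :* (cube δ :* sq (cube ν) :+ cube ι :* cube k) in
    cube (con 2ℚ :* (μ :* (δ :* ι :* (ν :* ν)))) :+ cube (con 2ℚ :* (μ :* (ι :* ι :* k))) :=
    ((M :+ M) :+ (M :+ M) :+ (M :+ M)) :* T :+ (M :+ M) :* T) refl μ ι δ ν k) ⟩
  a ^ℚ 3 ℚ.+ b ^ℚ 3
    ≤⟨ ^-superadditive a b 2 0≤a 0≤b ⟩
  (a ℚ.+ b) ^ℚ 3
    ≤⟨ ^-mono-≤ (a ℚ.+ b) (a ℚ.+ b ℚ.+ 2ℚ ℚ.* (μ ℚ.* w)) 3 (+-nonneg a b 0≤a 0≤b)
         (≤-from-diff _ (*-nonneg 2ℚ _ 0≤2 (*-nonneg μ w 0≤μ 0≤w)) refl) ⟩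
  (a ℚ.+ b ℚ.+ 2ℚ ℚ.* (μ ℚ.* w)) ^ℚ 3
    ≡⟨ cong (_^ℚ 3) (solve 6 (λ μ ι δ ν k w →
         con 2ℚ :* (μ :* (δ :* ι :* (ν :* ν))) :+ con 2ℚ :* (μ :* (ι :* ι :* k)) :+ con 2ℚ :* (μ :* w) :=
         con 2ℚ :* (μ :* con 1ℚ) :* ((δ :* con 1ℚ) :* (ι :* con 1ℚ) :* (ν :* (ν :* con 1ℚ)) :+ ι :* (ι :* con 1ℚ) :* k :+ w))
         refl μ ι δ ν k w) ⟩
  _ ∎
  where
  2ℚ = + 2 / 1
  0≤2 : 0ℚ ℚ.≤ 2ℚ
  0≤2 = ℚ.nonNegative⁻¹ 2ℚ
  M = μ ^ℚ 3
  T = ι ^ℚ 3 ℚ.* (δ ^ℚ 3 ℚ.* (ν ^ℚ 3) ^ℚ 2 ℚ.+ ι ^ℚ 3 ℚ.* k ^ℚ 3)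
  a = 2ℚ ℚ.* (μ ℚ.* (δ ℚ.* ι ℚ.* (ν ℚ.* ν)))
  b = 2ℚ ℚ.* (μ ℚ.* (ι ℚ.* ι ℚ.* k))
  0≤M = ^-nonneg μ 3 0≤μ
  0≤T = *-nonneg _ _ (^-nonneg ι 3 0≤ι) (+-nonneg _ _
    (*-nonneg _ _ (^-nonneg δ 3 0≤δ) (^-nonneg (ν ^ℚ 3) 2 (^-nonneg ν 3 0≤ν)))
    (*-nonneg _ _ (^-nonneg ι 3 0≤ι) (^-nonneg k 3 0≤k)))
  0≤a = *-nonneg 2ℚ _ 0≤2 (*-nonneg μ _ 0≤μ (*-nonneg _ _ (*-nonneg δ ι 0≤δ 0≤ι) (*-nonneg ν ν 0≤ν 0≤ν)))
  0≤b = *-nonneg 2ℚ _ 0≤2 (*-nonneg μ _ 0≤μ (*-nonneg _ k (*-nonneg ι ι 0≤ι 0≤ι) 0≤k))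

fromℕ-nonneg : ∀ k → Nonneg (fromℕ k)
fromℕ-nonneg k n = ℚ.nonNegative⁻¹ (+ k / 1) {{ℚ.normalize-nonNeg k 1}}

module _ {m : ℕ} .{{_ : NonZero m}} (φ : ℤ/ m → ℂ) (I D : Subset m) where

  private
    K = maxOver (∁ D) (λ a → ∣ 𝒞 φ a ∣ᶜ ^[ 1 / 3 ])
    E = sumℝ (λ x → ∣ φ x ∣ᶜ ^ 2) (elements ⊤)
    -- The energy computed without square roots: its n-th term is exactly the energy of the n-th
    -- approximation, whereas the terms of `E` carry the rounding of the moduli.
    E′ = sumℝ (normSq ∘ φ) (elements ⊤)
    μ = root 3 ‖ φ ‖∞
    ν = root 3 ‖ φ ‖₂
    ι = root 3 (fromℕ ∣ I ∣)
    δ = root 3 (fromℕ ∣ D ∣)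
    -- `T₁` contains the corrections `γ` that make the inequality true at every term. `T₂` is the
    -- same real number, written in the rounded roots from which `bound` is built.
    T₁ = cubic-bound (‖ φ ‖∞ + γ) (fromℕ ∣ I ∣) (fromℕ ∣ D ∣) E′ ((K + γ) ^ 3 + γ)
    T₂ = cubic-bound (μ ^ 3) (ι ^ 3) (δ ^ 3) ((ν ^ 3) ^ 2) (K ^ 3)
    W = fromℚ (+ 2 / 3) * fromℕ ∣ I ∣ ^[ 2 / 3 ] * ‖ φ ‖∞ ^[ 2 / 3 ]
    bound = fromℕ 2 * ‖ φ ‖∞ ^[ 1 / 3 ] *
      ( fromℕ ∣ D ∣ ^[ 1 / 3 ] * fromℕ ∣ I ∣ ^[ 1 / 3 ] * ‖ φ ‖₂ ^[ 2 / 3 ]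
      + fromℕ ∣ I ∣ ^[ 2 / 3 ] * K
      + W )

    ∞-nonneg : Nonneg ‖ φ ‖∞
    ∞-nonneg = maxOver-nonneg ⊤ (∣_∣ᶜ ∘ φ)

    K-nonneg : Nonneg K
    K-nonneg = maxOver-nonneg (∁ D) (λ a → ∣ 𝒞 φ a ∣ᶜ ^[ 1 / 3 ])

    module _ (n : ℕ) where
      g = grid n 1
      0≤g = grid-nonneg n 1

      φₙ : ℤ/ m → ℚ²
      φₙ = approx n ∘ φ

      φₙ≤sup : ∀ x → ‖ φₙ x ‖² ℚ.≤ (seq ‖ φ ‖∞ n ℚ.+ g) ℚ.* (seq ‖ φ ‖∞ n ℚ.+ g)
      φₙ≤sup x = ℚ.≤-trans (modulus-upper (φ x) n) (*-mono-≤ _ _ _ _ 0≤r (+-nonneg _ _ (∞-nonneg n) 0≤g) r≤ r≤)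
        where
        0≤r = +-nonneg _ _ (root-nonneg 2 (normSq (φ x)) n) 0≤g
        r≤ = ℚ.+-monoˡ-≤ g (≤-maxOver ⊤ (∣_∣ᶜ ∘ φ) {x} ∈⊤ n)

      energy : seq E′ n ≡ ∑[ x < m ] ‖ φₙ x ‖²
      energy = trans (seq-sumℝ (normSq ∘ φ) (elements ⊤) n)
        (trans (sumOver-⊤ {m} (λ x → seq (normSq (φ x)) n)) (sum-cong-≗ {m} (λ x → seq-normSq (φ x) n)))

      re-𝒞 : ∀ a → seq (re (𝒞 φ a)) n ≡ ∑[ x < m ] φₙ x ∙ φₙ (x ⊕ a)
      re-𝒞 a = trans (cong proj₁ (approx-sum (λ x → φ x *ᶜ conj (φ (x ⊕ a))) (elements ⊤) n))
        (trans (sumOver-⊤ {m} _) (sum-cong-≗ {m} (λ x →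
          solve 4 (λ a b c d → a :* c :- b :* (:- d) := a :* c :+ b :* d) refl
            (seq (re (φ x)) n) (seq (im (φ x)) n) (seq (re (φ (x ⊕ a))) n) (seq (im (φ (x ⊕ a))) n))))

      -- Two roundings are compensated: the inner `g` for the cube root defining `K`, the outer one
      -- for the square root in the modulus of the correlation.
      𝒞-bound : ∀ a → a ∉ₛ D → ∑[ x < m ] φₙ x ∙ φₙ (x ⊕ a) ℚ.≤ (seq K n ℚ.+ g) ^ℚ 3 ℚ.+ g
      𝒞-bound a a∉D = begin
        ∑[ x < m ] φₙ x ∙ φₙ (x ⊕ a)
          ≡⟨ re-𝒞 a ⟨
        seq (re (𝒞 φ a)) n
          ≤⟨ re≤modulus (𝒞 φ a) n ⟩
        seq ∣ 𝒞 φ a ∣ᶜ n ℚ.+ g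
          ≤⟨ ℚ.+-monoˡ-≤ g (ℚ.≤-trans (≤-root+γ-^ 3 ∣ 𝒞 φ a ∣ᶜ n) (^-mono-≤ _ _ 3
               (+-nonneg _ _ (root-nonneg 3 ∣ 𝒞 φ a ∣ᶜ n) 0≤g)
               (ℚ.+-monoˡ-≤ g (ℚ.≤-trans (ℚ.≤-reflexive (sym (ℚ.*-identityʳ (seq (root 3 ∣ 𝒞 φ a ∣ᶜ) n))))
                 (≤-maxOver (∁ D) (λ a → ∣ 𝒞 φ a ∣ᶜ ^[ 1 / 3 ]) (x∉p⇒x∈∁p a∉D) n))))) ⟩
        (seq K n ℚ.+ g) ^ℚ 3 ℚ.+ g ∎

    -- Finite sums and products of reals are computed termwise, so `interval-cube-bound` applies to
    -- the n-th approximation of `φ` for each n. The modulus on the left is rounded down, and the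
    -- corrections on the right bound the true maxima from above.
    cube≤T₁ : IsInterval I → ∣ S φ I ∣ᶜ ^ 3 ≤ T₁
    cube≤T₁ interval = pointwise-≤ {∣ S φ I ∣ᶜ ^ 3} {T₁} λ n → begin
      s n ^ℚ 3
        ≡⟨ cong (λ r → s n ℚ.* (s n ℚ.* r)) (ℚ.*-identityʳ (s n)) ⟩
      s n ³
        ≤⟨ Interval.interval-cube-bound (φₙ n) {I} {D} interval
             (+-nonneg _ _ (∞-nonneg n) (grid-nonneg n 1)) (φₙ≤sup n)
             (+-nonneg _ _ (^-nonneg _ 3 (+-nonneg _ _ (K-nonneg n) (grid-nonneg n 1))) (grid-nonneg n 1)) (𝒞-bound n)
             (root-nonneg 2 (normSq (S φ I)) n)
             (subst (λ z → s n ℚ.* s n ℚ.≤ ‖ z ‖²) (approx-sum φ (elements I) n) (modulus-lower (S φ I) n)) ⟩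
      _ ≡⟨ cong (λ e → 6M n ℚ.* (i ℚ.* (d ℚ.* e ℚ.+ i ℚ.* seq ((K + γ) ^ 3 + γ) n))) (energy n) ⟨
      seq T₁ n ∎
      where
      s = seq ∣ S φ I ∣ᶜ
      i = + ∣ I ∣ / 1
      d = + ∣ D ∣ / 1
      6M : ℕ → ℚ
      6M n = seq (let M = ‖ φ ‖∞ + γ in M + M + (M + M) + (M + M)) n

    -- Argument by argument: `γ` is zero as a real, each cube of a cube root returns the original
    -- quantity, and the energy is the square of `‖ φ ‖₂`, hence of `ν ^ 3`.
    T₁≈T₂ : T₁ ≈ T₂
    T₁≈T₂ = cubic-bound-cong
      {‖ φ ‖∞ + γ} {μ ^ 3} {fromℕ ∣ I ∣} {ι ^ 3} {fromℕ ∣ D ∣} {δ ^ 3} {E′} {(ν ^ 3) ^ 2} {(K + γ) ^ 3 + γ} {K ^ 3}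
      (≈-trans {‖ φ ‖∞ + γ} {‖ φ ‖∞} {μ ^ 3} (+γ ‖ φ ‖∞) (≈-sym {μ ^ 3} {‖ φ ‖∞} (root-^ 3 ‖ φ ‖∞ ∞-nonneg)))
      (≈-sym {ι ^ 3} {fromℕ ∣ I ∣} (root-^ 3 (fromℕ ∣ I ∣) (fromℕ-nonneg ∣ I ∣)))
      (≈-sym {δ ^ 3} {fromℕ ∣ D ∣} (root-^ 3 (fromℕ ∣ D ∣) (fromℕ-nonneg ∣ D ∣)))
      (≈-trans {E′} {E} {(ν ^ 3) ^ 2}
        (sumℝ-cong {f = normSq ∘ φ} {λ x → ∣ φ x ∣ᶜ ^ 2}
          (λ x → ≈-sym {∣ φ x ∣ᶜ ^ 2} {normSq (φ x)} (root-^ 2 (normSq (φ x)) (normSq-nonneg (φ x)))) (elements ⊤))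
        (≈-trans {E} {‖ φ ‖₂ ^ 2} {(ν ^ 3) ^ 2}
          (≈-trans {E} {root 2 E ^ 2} {‖ φ ‖₂ ^ 2} (≈-sym {root 2 E ^ 2} {E} (root-^ 2 E E-nonneg))
            -- The exponent `[ 1 / 2 ]` makes `‖ φ ‖₂` the product of `root 2 E` with 1.
            (^-cong {root 2 E} {‖ φ ‖₂} 2 (pointwise-≈ {root 2 E} {‖ φ ‖₂} (λ n → sym (ℚ.*-identityʳ _)))))
          (^-cong {‖ φ ‖₂} {ν ^ 3} 2 (≈-sym {ν ^ 3} {‖ φ ‖₂} (root-^ 3 ‖ φ ‖₂ 2-nonneg)))))
      (≈-trans {(K + γ) ^ 3 + γ} {(K + γ) ^ 3} {K ^ 3} (+γ ((K + γ) ^ 3)) (^-cong {K + γ} {K} 3 (+γ K)))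
      where
      2-nonneg : Nonneg ‖ φ ‖₂
      2-nonneg n = *-nonneg _ _ (root-nonneg 2 E n) 0≤1
      E-nonneg : Nonneg E
      E-nonneg n = subst (0ℚ ℚ.≤_)
        (sym (trans (seq-sumℝ (λ x → ∣ φ x ∣ᶜ ^ 2) (elements ⊤) n) (sumOver-⊤ {m} _)))
        (sum-nonneg {m} (λ x → ^-nonneg _ 2 (root-nonneg 2 (normSq (φ x)) n)))

    μ-nonneg = root-nonneg 3 ‖ φ ‖∞
    ν-nonneg = root-nonneg 3 ‖ φ ‖₂
    ι-nonneg = root-nonneg 3 (fromℕ ∣ I ∣)
    δ-nonneg = root-nonneg 3 (fromℕ ∣ D ∣)

    W-nonneg : Nonneg W
    W-nonneg n = *-nonneg _ _ (*-nonneg (+ 2 / 3) _ (ℚ.nonNegative⁻¹ (+ 2 / 3)) (^-nonneg _ 2 (ι-nonneg n)))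
                              (^-nonneg _ 2 (μ-nonneg n))

    -- Both sides are polynomials in the same roots `μ`, `ι`, `δ`, `ν` and in `K`, `W`, so the
    -- rational inequality holds at every term without correction.
    T₂≤bound³ : T₂ ≤ bound ^ 3
    T₂≤bound³ = pointwise-≤ {T₂} {bound ^ 3} λ n → cube-of-bound
      (seq μ n) (seq ι n) (seq δ n) (seq ν n) (seq K n) (seq W n)
      (μ-nonneg n) (ι-nonneg n) (δ-nonneg n) (ν-nonneg n) (K-nonneg n) (W-nonneg n)

    bound-nonneg : Nonneg bound
    bound-nonneg n = *-nonneg _ _
      (*-nonneg (+ 2 / 1) _ (ℚ.nonNegative⁻¹ (+ 2 / 1)) (^-nonneg _ 1 (μ-nonneg n)))
      (+-nonneg _ _ (+-nonneg _ _
        (*-nonneg _ _ (*-nonneg _ _ (^-nonneg _ 1 (δ-nonneg n)) (^-nonneg _ 1 (ι-nonneg n))) (^-nonneg _ 2 (ν-nonneg n)))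
        (*-nonneg _ _ (^-nonneg _ 2 (ι-nonneg n)) (K-nonneg n))) (W-nonneg n))

  interval-sum-bound : IsInterval I → ∣ S φ I ∣ᶜ ≤ bound
  interval-sum-bound interval = ^-cancel-≤ 2 {∣ S φ I ∣ᶜ} {bound} bound-nonneg
    (≤-trans {∣ S φ I ∣ᶜ ^ 3} {T₁} {bound ^ 3} (cube≤T₁ interval)
      (≤-trans {T₁} {T₂} {bound ^ 3} (proj₁ T₁≈T₂) T₂≤bound³))

theorem2p1 : (m : ℕ) .{{_ : NonZero m}} (φ : ℤ/ m → ℂ) (I D : Subset m) →
    IsInterval I →
    ∣ S φ I ∣ᶜ ≤
    fromℕ 2 * ‖ φ ‖∞ ^[ 1 / 3 ] *
    ( fromℕ ∣ D ∣ ^[ 1 / 3 ] * fromℕ ∣ I ∣ ^[ 1 / 3 ] * ‖ φ ‖₂ ^[ 2 / 3 ]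
    + fromℕ ∣ I ∣ ^[ 2 / 3 ] * maxOver (∁ D) (λ a → ∣ 𝒞 φ a ∣ᶜ ^[ 1 / 3 ])
    + fromℚ (+ 2 / 3) * fromℕ ∣ I ∣ ^[ 2 / 3 ] * ‖ φ ‖∞ ^[ 2 / 3 ] )
theorem2p1 m φ I D = interval-sum-bound φ I D
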